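{- Every hereditary small graph class admits an $O(\log^3 n)$-bit adjacency labeling scheme.
   Context: A class of graphs is a set of graphs closed under isomorphism; it is hereditary if closed under taking induced subgraphs. $\mathcal{X}_n$ denotes the set of graphs in $\mathcal{X}$ with vertex set $[n]$. A hereditary class $\mathcal{X}$ is small if there is a constant $c$ with $|\mathcal{X}_n|\le n!\cdot c^n$ for all $n$. For a function $b:\mathbb{N}\to\mathbb{N}$, a $b(n)$-bit adjacency labeling scheme for $\mathcal{X}$ is a pair (encoder, decoder) where for every $G\in\mathcal{X}_n$ the encoder assigns to each vertex a binary string of length $b(n)$ such that the decoder, which depends only on $\mathcal{X}$ and not on $G$, determines whether two vertices are adjacent from their two labels alone. -}

module Defs where

open import Data.Nat using (ℕ; _≤_; _*_; _^_; _!)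
open import Data.Nat.Logarithm using (⌈log₂_⌉)
open import Data.Fin using (Fin)
open import Data.Bool using (Bool; false)
open import Data.Vec using (Vec; toList)
open import Data.List using (List; length)
open import Data.List.Relation.Unary.All using (All)
open import Data.List.Relation.Unary.AllPairs using (AllPairs)
open import Data.Product using (Σ; ∃; ∃-syntax; _×_)
open import Function using (_↔_; Inverse)
open import Function.Definitions using (Injective)
open import Relation.Binary.PropositionalEquality using (_≡_; _≢_; trans; sym)

record Graph (n : ℕ) : Set where
  field
    adj    : Fin n → Fin n → Bool
    adj-sym : ∀ i j → adj i j ≡ adj j i
    irrefl : ∀ i → adj i i ≡ false
open Graph public

Isomorphic : ∀ {n} → Graph n → Graph n → Set
Isomorphic {n} G H =
  Σ (Fin n ↔ Fin n) λ σ → ∀ i j → adj H (Inverse.to σ i) (Inverse.to σ j) ≡ adj G i j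

induced : ∀ {m n} → Graph n → (f : Fin m → Fin n) → Injective _≡_ _≡_ f → Graph m
induced G f _ = record
  { adj = λ i j → adj G (f i) (f j)
  ; adj-sym = λ i j → adj-sym G (f i) (f j)
  ; irrefl = λ i → irrefl G (f i)
  }

record GraphClass : Set₁ where
  field
    X : (n : ℕ) → Graph n → Set
    iso-closed : ∀ {n} (G H : Graph n) → Isomorphic G H → X n G → X n H
open GraphClass public

Hereditary : GraphClass → Set
Hereditary 𝒳 = ∀ {m n} (G : Graph n) (f : Fin m → Fin n) (inj : Injective _≡_ _≡_ f) →
  X 𝒳 n G → X 𝒳 m (induced G f inj)

Distinct : ∀ {n} → Graph n → Graph n → Set
Distinct G H = ∃[ i ] ∃[ j ] (adj G i j ≢ adj H i j)

-- |X_n| ≤ N, expressed as: every duplicate-free list of members of X_n has length ≤ N.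
CardX≤ : GraphClass → ℕ → ℕ → Set
CardX≤ 𝒳 n N = (gs : List (Graph n)) → All (X 𝒳 n) gs → AllPairs Distinct gs → length gs ≤ N

Small : GraphClass → Set
Small 𝒳 = ∃[ c ] ∀ n → CardX≤ 𝒳 n ((n !) * c ^ n)

record LabelingScheme (𝒳 : GraphClass) (b : ℕ → ℕ) : Set where
  field
    decoder : List Bool → List Bool → Bool
    encoder : ∀ {n} (G : Graph n) → X 𝒳 n G → Fin n → Vec Bool (b n)
    correct : ∀ {n} (G : Graph n) (g : X 𝒳 n G) (i j : Fin n) →
      decoder (toList (encoder G g i)) (toList (encoder G g j)) ≡ adj G i j

IsOLog³ : (ℕ → ℕ) → Set
IsOLog³ b = ∃[ C ] ∃[ N ] ∀ n → N ≤ n → b n ≤ C * ⌈log₂ n ⌉ ^ 3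

{-# OPTIONS --safe #-}

-- Let G be an n-vertex graph of the class and L about log n.
--
-- If a set A of m vertices had many more than m log m distinct traces N(v) ∩ A,
-- then adding to A arbitrary sequences of m log m vertices with pairwise distinct
-- traces would give more labelled graphs than smallness allows.  So there are
-- O(m L) traces, and the VC dimension d is bounded by a constant.  Haussler's
-- packing argument then applies: the one-inclusion graph of the traces on a
-- random sequence of s vertices has at most d edges per vertex, whereas many
-- vertices at pairwise large weighted distance would force more.  Hence among any
-- k vertices, and for any weights, two vertices x and y are distinguished by a
-- fraction O(L / k) of the total weight.  Removing x, doubling the weight of the
-- vertices distinguishing x from y, recursing, and finally inserting x just after
-- y, one obtains a linear order of the vertices in which every neighbourhood is a
-- union of O(L²) intervals.  A label consists of the position of the vertex and of
-- the endpoints of these intervals, O(L) bits each.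

module Submission where

open import Defs
open import Data.Bool using (Bool; true; false; not; if_then_else_; _xor_; T?)
open import Data.Bool.Properties using (T-≡; T-not-≡; xor-identityʳ; not-involutive)
open import Data.Empty using (⊥-elim)
open import Data.Fin using (Fin; zero; suc; toℕ; _↑ˡ_; _↑ʳ_; punchIn; splitAt; inject≤; finToFun; funToFin; combine)
open import Data.Fin.Properties using (_≟_; toℕ<n; ↑ʳ-injective; punchIn-injective; punchInᵢ≢i; splitAt-↑ˡ; splitAt-↑ʳ; join-splitAt; injective⇒≤; inject≤-injective; funToFin-finToFin; ¬∀⟶∃¬)
open import Data.List as List using (List; []; _∷_; _++_; length; map; foldr; replicate; filterᵇ; filter; deduplicate; tabulate; allFin)
open import Data.List.Membership.Propositional using (_∈_; lose; find)
open import Data.List.Membership.Propositional.Properties using (∈-lookup; ∈-filter⁻; ∈-deduplicate⁺; ∈-deduplicate⁻; ∈-tabulate⁺; ∈-allFin)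
import Data.List.Membership.DecPropositional as DecMembership
open import Data.List.Properties using (length-++; length-replicate; length-tabulate)
open import Data.List.Relation.Unary.All as All using (All; []; _∷_)
import Data.List.Relation.Unary.All.Properties as Allₚ
open import Data.List.Relation.Unary.AllPairs as AllPairs using (AllPairs; []; _∷_)
import Data.List.Relation.Unary.AllPairs.Properties as AllPairsₚ
open import Data.List.Relation.Unary.Any as Any using (Any; here; there)
open import Data.List.Relation.Unary.Any.Properties using (lookup-index)
open import Data.List.Relation.Unary.Unique.DecPropositional.Properties using (deduplicate-!)
open import Data.List.Relation.Unary.Unique.Propositional using (Unique)
import Data.List.Relation.Unary.Unique.Propositional.Properties as Uniqueₚ
open import Data.Nat hiding (_≟_; _/_)
open import Data.Nat.DivMod using (_/_; m/n*n≤m; m≡m%n+[m/n]*n; m%n<n; m≥n⇒m/n>0)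
open import Data.Nat.Induction using (<-rec)
open import Data.Nat.Logarithm using (⌈log₂_⌉; ⌈log₂⌉-mono-≤; ⌈log₂⌈n/2⌉⌉≡⌈log₂n⌉∸1)
open import Data.Nat.Properties hiding (_≟_)
open import Algebra.Properties.Semiring.Sum +-*-semiring using (sum; sum-cong-≗; ∑-distrib-+; ∑-comm; *-distribˡ-sum; *-distribʳ-sum)
open import Data.Nat.Tactic.RingSolver using (solve-∀)
open import Data.Product using (Σ; ∃-syntax; _×_; _,_; proj₁; proj₂)
open import Data.Sum as Sum using (_⊎_; inj₁; inj₂; [_,_]′)
open import Data.Vec using (Vec; []; _∷_; lookup; toList; fromList)
open import Data.Vec.Properties using (length-toList; toList∘fromList)
open import Function using (_∘_; id; it; Equivalence)
open import Function.Definitions using (Injective)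
open import Level using (0ℓ)
open import Relation.Binary.Definitions using (Symmetric)
open import Relation.Binary.PropositionalEquality
open import Relation.Nullary using (¬_; Dec; yes; no; contradiction)
open import Relation.Nullary.Decidable using (¬?; does; dec-true; dec-false)
open import Relation.Unary using (Pred; Decidable)

-- Indicators and finite sums.

bit : Bool → ℕ
bit false = 0
bit true  = 1

bit≤1 : ∀ b → bit b ≤ 1
bit≤1 false = z≤n
bit≤1 true  = ≤-refl

sum-mono : ∀ {n} {f g : Fin n → ℕ} → (∀ i → f i ≤ g i) → sum f ≤ sum g
sum-mono {zero}  f≤g = z≤n
sum-mono {suc n} f≤g = +-mono-≤ (f≤g zero) (sum-mono (f≤g ∘ suc))

term≤sum : ∀ {n} (f : Fin n → ℕ) i → f i ≤ sum f
term≤sum f zero    = m≤m+n _ _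
term≤sum f (suc i) = ≤-trans (term≤sum (f ∘ suc) i) (m≤n+m _ _)

-- One-inclusion graphs of weighted set systems

-- A weight on the cube is a multiset of binary words, `w u` being the multiplicity of `u`.
-- Multiplicities are kept because many vertices may share a trace on a short sample.
size : ∀ {m} → (Vec Bool m → ℕ) → ℕ
size {zero}  w = w []
size {suc m} w = size (w ∘ (false ∷_)) + size (w ∘ (true ∷_))

support : ∀ {m} → (Vec Bool m → ℕ) → ℕ
support {zero}  w = 1 ⊓ w []
support {suc m} w = support (w ∘ (false ∷_)) + support (w ∘ (true ∷_))

-- The edges of the hypercube, each weighted by the minimum over its two ends.
edges : ∀ {m} → (Vec Bool m → ℕ) → ℕ
edges {zero}  w = 0
edges {suc m} w = edges w₀ + edges w₁ + size (λ u → w₀ u ⊓ w₁ u)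
  where
  w₀ = w ∘ (false ∷_)
  w₁ = w ∘ (true ∷_)

+-interchange : ∀ a b c d → (a + b) + (c + d) ≡ (a + c) + (b + d)
+-interchange = solve-∀

size-cong : ∀ {m} {v w : Vec Bool m → ℕ} → (∀ u → v u ≡ w u) → size v ≡ size w
size-cong {zero}  v≗w = v≗w []
size-cong {suc m} v≗w = cong₂ _+_ (size-cong (v≗w ∘ (false ∷_))) (size-cong (v≗w ∘ (true ∷_)))

size-mono : ∀ {m} {v w : Vec Bool m → ℕ} → (∀ u → v u ≤ w u) → size v ≤ size w
size-mono {zero}  v≤w = v≤w []
size-mono {suc m} v≤w = +-mono-≤ (size-mono (v≤w ∘ (false ∷_))) (size-mono (v≤w ∘ (true ∷_)))

size-+ : ∀ {m} (v w : Vec Bool m → ℕ) → size (λ u → v u + w u) ≡ size v + size w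
size-+ {zero}  v w = refl
size-+ {suc m} v w =
  trans (cong₂ _+_ (size-+ (v ∘ (false ∷_)) (w ∘ (false ∷_))) (size-+ (v ∘ (true ∷_)) (w ∘ (true ∷_))))
        (+-interchange (size (v ∘ (false ∷_))) (size (w ∘ (false ∷_))) _ _)

edges≤*size : ∀ {m} (w : Vec Bool m → ℕ) → edges w ≤ m * size w
edges≤*size {zero}  w = z≤n
edges≤*size {suc m} w = begin
  edges w₀ + edges w₁ + size (λ u → w₀ u ⊓ w₁ u)
    ≤⟨ +-mono-≤ (+-mono-≤ (edges≤*size w₀) (edges≤*size w₁)) (size-mono (λ u → m⊓n≤m (w₀ u) (w₁ u))) ⟩
  m * size w₀ + m * size w₁ + size w₀
    ≤⟨ m≤m+n _ (size w₁) ⟩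
  m * size w₀ + m * size w₁ + size w₀ + size w₁
    ≡⟨ rearrange m (size w₀) (size w₁) ⟩
  size w₀ + size w₁ + m * (size w₀ + size w₁) ∎
  where
  open ≤-Reasoning
  w₀ = w ∘ (false ∷_)
  w₁ = w ∘ (true ∷_)
  rearrange : ∀ m a b → m * a + m * b + a + b ≡ a + b + m * (a + b)
  rearrange = solve-∀

-- The smaller of the two minima is a lower bound for all four numbers, hence for the last term; the
-- larger one is below the minimum of the two maxima.
⊓-exchange : ∀ a b c d → a ⊓ b + c ⊓ d ≤ (a ⊔ c) ⊓ (b ⊔ d) + (a ⊓ c) ⊓ (b ⊓ d)
⊓-exchange a b c d with ≤-total (a ⊓ b) (c ⊓ d)
... | inj₁ p = begin
  a ⊓ b + c ⊓ d
    ≡⟨ +-comm (a ⊓ b) _ ⟩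
  c ⊓ d + a ⊓ b
    ≤⟨ +-mono-≤ (⊓-mono-≤ (m≤n⊔m a c) (m≤n⊔m b d))
        (⊓-glb (⊓-glb (m⊓n≤m a b) (≤-trans p (m⊓n≤m c d)))
               (⊓-glb (m⊓n≤n a b) (≤-trans p (m⊓n≤n c d)))) ⟩
  (a ⊔ c) ⊓ (b ⊔ d) + (a ⊓ c) ⊓ (b ⊓ d) ∎
  where open ≤-Reasoning
... | inj₂ p =
  +-mono-≤ (⊓-mono-≤ (m≤m⊔n a c) (m≤m⊔n b d))
    (⊓-glb (⊓-glb (≤-trans p (m⊓n≤m a b)) (m⊓n≤m c d))
           (⊓-glb (≤-trans p (m⊓n≤n a b)) (m⊓n≤n c d)))

-- With `v` and `w` as the two halves of a weight along one coordinate, passing to maximum and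
-- minimum is the down-shift in that coordinate. It loses no edges inside the halves: `⊓-exchange`
-- shows this in each direction.
edges-compress : ∀ {m} (v w : Vec Bool m → ℕ) →
  edges v + edges w ≤ edges (λ u → v u ⊔ w u) + edges (λ u → v u ⊓ w u)
edges-compress {zero}  v w = z≤n
edges-compress {suc m} v w = begin
  (edges v₀ + edges v₁ + size (λ u → v₀ u ⊓ v₁ u)) + (edges w₀ + edges w₁ + size (λ u → w₀ u ⊓ w₁ u))
    ≡⟨ rearrange (edges v₀) (edges v₁) _ (edges w₀) (edges w₁) _ ⟩
  (edges v₀ + edges w₀) + (edges v₁ + edges w₁)
    + (size (λ u → v₀ u ⊓ v₁ u) + size (λ u → w₀ u ⊓ w₁ u))
    ≤⟨ +-mono-≤ (+-mono-≤ (edges-compress v₀ w₀) (edges-compress v₁ w₁)) sizes ⟩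
  (edges (λ u → v₀ u ⊔ w₀ u) + edges (λ u → v₀ u ⊓ w₀ u)) + (edges (λ u → v₁ u ⊔ w₁ u) + edges (λ u → v₁ u ⊓ w₁ u))
    + (size (λ u → (v₀ u ⊔ w₀ u) ⊓ (v₁ u ⊔ w₁ u)) + size (λ u → (v₀ u ⊓ w₀ u) ⊓ (v₁ u ⊓ w₁ u)))
    ≡⟨ rearrange (edges (λ u → v₀ u ⊔ w₀ u)) (edges (λ u → v₁ u ⊔ w₁ u)) _ (edges (λ u → v₀ u ⊓ w₀ u)) (edges (λ u → v₁ u ⊓ w₁ u)) _ ⟨
  _ ∎
  where
  open ≤-Reasoning
  v₀ = v ∘ (false ∷_)
  v₁ = v ∘ (true ∷_)
  w₀ = w ∘ (false ∷_)
  w₁ = w ∘ (true ∷_)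
  rearrange : ∀ a b c d e f → (a + b + c) + (d + e + f) ≡ (a + d) + (b + e) + (c + f)
  rearrange = solve-∀
  sizes : size (λ u → v₀ u ⊓ v₁ u) + size (λ u → w₀ u ⊓ w₁ u)
        ≤ size (λ u → (v₀ u ⊔ w₀ u) ⊓ (v₁ u ⊔ w₁ u)) + size (λ u → (v₀ u ⊓ w₀ u) ⊓ (v₁ u ⊓ w₁ u))
  sizes = begin
    size (λ u → v₀ u ⊓ v₁ u) + size (λ u → w₀ u ⊓ w₁ u)
      ≡⟨ size-+ (λ u → v₀ u ⊓ v₁ u) (λ u → w₀ u ⊓ w₁ u) ⟨
    size (λ u → v₀ u ⊓ v₁ u + w₀ u ⊓ w₁ u)
      ≤⟨ size-mono (λ u → ⊓-exchange (v₀ u) (v₁ u) (w₀ u) (w₁ u)) ⟩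
    size (λ u → (v₀ u ⊔ w₀ u) ⊓ (v₁ u ⊔ w₁ u) + (v₀ u ⊓ w₀ u) ⊓ (v₁ u ⊓ w₁ u))
      ≡⟨ size-+ (λ u → (v₀ u ⊔ w₀ u) ⊓ (v₁ u ⊔ w₁ u)) (λ u → (v₀ u ⊓ w₀ u) ⊓ (v₁ u ⊓ w₁ u)) ⟩
    _ ∎

-- Here `pos` is automatically injective: patterns that differ at two given indices have to be
-- realised as well.
Shatters : ∀ {m} → (Vec Bool m → ℕ) → ℕ → Set
Shatters {m} w d = Σ (Fin d → Fin m) λ pos →
  (t : Fin d → Bool) → ∃[ u ] (0 < w u × (∀ i → lookup u (pos i) ≡ t i))

size-zero-or-positive : ∀ {m} (w : Vec Bool m → ℕ) → size w ≡ 0 ⊎ (∃[ u ] 0 < w u)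
size-zero-or-positive {zero} w with w [] in eq
... | zero  = inj₁ refl
... | suc k = inj₂ ([] , subst (0 <_) (sym eq) z<s)
size-zero-or-positive {suc m} w
  with size-zero-or-positive (w ∘ (false ∷_)) | size-zero-or-positive (w ∘ (true ∷_))
... | inj₂ (u , p) | _            = inj₂ (false ∷ u , p)
... | inj₁ _       | inj₂ (u , p) = inj₂ (true ∷ u , p)
... | inj₁ p       | inj₁ q       = inj₁ (cong₂ _+_ p q)

⊔-positive : ∀ a b → 0 < a ⊔ b → 0 < a ⊎ 0 < b
⊔-positive zero    b p = inj₂ p
⊔-positive (suc a) b p = inj₁ z<s

-- Induction over the coordinates: the pointwise maximum of the two halves of w
-- shatters only what w shatters, and adding the removed coordinate to a set
-- shattered by their minimum gives a set shattered by w.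
shatters-or-sparse : ∀ {m} (w : Vec Bool m → ℕ) d → Shatters w d ⊎ edges w + size w ≤ d * size w
shatters-or-sparse {m} w zero with size-zero-or-positive w
... | inj₂ (u , p) = inj₁ ((λ ()) , λ t → u , p , λ ())
... | inj₁ p = inj₂ (begin
  edges w + size w    ≤⟨ +-monoˡ-≤ (size w) (edges≤*size w) ⟩
  m * size w + size w ≡⟨ cong (λ z → m * z + z) p ⟩
  m * 0 + 0           ≡⟨ trans (+-identityʳ _) (*-zeroʳ m) ⟩
  0                   ∎)
  where open ≤-Reasoning
shatters-or-sparse {zero}  w (suc d) = inj₂ (m≤m+n _ _)
shatters-or-sparse {suc m} w (suc d)
  with shatters-or-sparse (λ u → w (false ∷ u) ⊔ w (true ∷ u)) (suc d)
     | shatters-or-sparse (λ u → w (false ∷ u) ⊓ w (true ∷ u)) d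
... | inj₁ (pos , shat) | _ = inj₁ (suc ∘ pos , realise)
  where
  realise : ∀ t → ∃[ u ] (0 < w u × (∀ i → lookup u (suc (pos i)) ≡ t i))
  realise t with shat t
  ... | u , p , eq with ⊔-positive (w (false ∷ u)) _ p
  ...   | inj₁ q = false ∷ u , q , eq
  ...   | inj₂ q = true ∷ u , q , eq
... | inj₂ _ | inj₁ (pos , shat) = inj₁ (pos′ , realise)
  where
  pos′ : Fin (suc d) → Fin (suc m)
  pos′ zero    = zero
  pos′ (suc i) = suc (pos i)
  half : ∀ b u → 0 < w (false ∷ u) ⊓ w (true ∷ u) → 0 < w (b ∷ u)
  half false u p = ≤-trans p (m⊓n≤m _ _)
  half true  u p = ≤-trans p (m⊓n≤n (w (false ∷ u)) _)
  realise : ∀ t → ∃[ u ] (0 < w u × (∀ i → lookup u (pos′ i) ≡ t i))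
  realise t with shat (t ∘ suc)
  ... | u , p , eq = t zero ∷ u , half (t zero) u p , λ { zero → refl ; (suc i) → eq i }
-- The minimum obeys the bound with `d` in place of `suc d`; the `size mn` saved there pays for the
-- edges along the first coordinate.
... | inj₂ p | inj₂ q = inj₂ (begin
  edges w₀ + edges w₁ + size (λ u → w₀ u ⊓ w₁ u) + (size w₀ + size w₁)
    ≡⟨ cong (edges w₀ + edges w₁ + size mn +_) sizes ⟩
  edges w₀ + edges w₁ + size mn + (size mx + size mn)
    ≤⟨ +-monoˡ-≤ _ (+-monoˡ-≤ _ (edges-compress w₀ w₁)) ⟩
  edges mx + edges mn + size mn + (size mx + size mn)
    ≡⟨ rearrange (edges mx) (edges mn) (size mx) (size mn) ⟩
  (edges mx + size mx) + (edges mn + size mn) + size mn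
    ≤⟨ +-monoˡ-≤ _ (+-mono-≤ p q) ⟩
  suc d * size mx + d * size mn + size mn
    ≡⟨ factor d (size mx) (size mn) ⟩
  suc d * (size mx + size mn)
    ≡⟨ cong (suc d *_) sizes ⟨
  suc d * (size w₀ + size w₁) ∎)
  where
  open ≤-Reasoning
  w₀ = w ∘ (false ∷_)
  w₁ = w ∘ (true ∷_)
  mx = λ u → w₀ u ⊔ w₁ u
  mn = λ u → w₀ u ⊓ w₁ u
  ⊔+⊓ : ∀ a b → a + b ≡ a ⊔ b + a ⊓ b
  ⊔+⊓ a b with ≤-total a b
  ... | inj₁ a≤b rewrite m≤n⇒m⊔n≡n a≤b | m≤n⇒m⊓n≡m a≤b = +-comm a b
  ... | inj₂ b≤a rewrite m≥n⇒m⊔n≡m b≤a | m≥n⇒m⊓n≡n b≤a = refl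
  sizes : size w₀ + size w₁ ≡ size mx + size mn
  sizes = trans (sym (size-+ w₀ w₁)) (trans (size-cong (λ u → ⊔+⊓ (w₀ u) (w₁ u))) (size-+ mx mn))
  rearrange : ∀ a b c d → a + b + d + (c + d) ≡ (a + c) + (b + d) + d
  rearrange = solve-∀
  factor : ∀ d a b → suc d * a + d * b + b ≡ suc d * (a + b)
  factor = solve-∀

-- Haussler's packing bound

module Integral {n : ℕ} (ω : Fin n → ℕ) where

  total : ℕ
  total = sum ω

  ∫ : (Fin n → ℕ) → ℕ
  ∫ F = sum (λ a → ω a * F a)

  ∫-cong : ∀ {F G} → (∀ a → F a ≡ G a) → ∫ F ≡ ∫ G
  ∫-cong F≗G = sum-cong-≗ (λ a → cong (ω a *_) (F≗G a))

  ∫-mono : ∀ {F G} → (∀ a → F a ≤ G a) → ∫ F ≤ ∫ G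
  ∫-mono F≤G = sum-mono (λ a → *-monoʳ-≤ (ω a) (F≤G a))

  ∫-+ : ∀ F G → ∫ (λ a → F a + G a) ≡ ∫ F + ∫ G
  ∫-+ F G = trans (sum-cong-≗ (λ a → *-distribˡ-+ (ω a) (F a) (G a))) (∑-distrib-+ (λ a → ω a * F a) (λ a → ω a * G a))

  ∫-* : ∀ k F → ∫ (λ a → k * F a) ≡ k * ∫ F
  ∫-* k F = trans (sum-cong-≗ (λ a → x∙yz≡y∙xz (ω a) k (F a))) (sym (*-distribˡ-sum k (λ a → ω a * F a)))
    where
    x∙yz≡y∙xz : ∀ x y z → x * (y * z) ≡ y * (x * z)
    x∙yz≡y∙xz = solve-∀

  ∫-const : ∀ k → ∫ (λ _ → k) ≡ total * k
  ∫-const k = sym (*-distribʳ-sum k ω)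

  ∫-swap : ∀ (F : Fin n → Fin n → ℕ) → ∫ (λ a → ∫ (F a)) ≡ ∫ (λ b → ∫ (λ a → F a b))
  ∫-swap F = begin
    sum (λ a → ω a * sum (λ b → ω b * F a b))   ≡⟨ sum-cong-≗ (λ a → *-distribˡ-sum (ω a) (λ b → ω b * F a b)) ⟩
    sum (λ a → sum (λ b → ω a * (ω b * F a b))) ≡⟨ ∑-comm (λ a b → ω a * (ω b * F a b)) ⟩
    sum (λ b → sum (λ a → ω a * (ω b * F a b))) ≡⟨ sum-cong-≗ (λ b → ∫-* (ω b) (λ a → F a b)) ⟩
    sum (λ b → ω b * sum (λ a → ω a * F a b))   ∎
    where open ≡-Reasoning

  -- The expectation over `s` independent points drawn in proportion to `ω`, without the normalising
  -- factor `total ^ s`.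
  ∫* : ∀ s → (Vec (Fin n) s → ℕ) → ℕ
  ∫* zero    F = F []
  ∫* (suc s) F = ∫ (λ a → ∫* s (λ p → F (a ∷ p)))

  ∫*-mono : ∀ s {F G} → (∀ p → F p ≤ G p) → ∫* s F ≤ ∫* s G
  ∫*-mono zero    F≤G = F≤G []
  ∫*-mono (suc s) F≤G = ∫-mono (λ a → ∫*-mono s (λ p → F≤G (a ∷ p)))

  ∫*-+ : ∀ s F G → ∫* s (λ p → F p + G p) ≡ ∫* s F + ∫* s G
  ∫*-+ zero    F G = refl
  ∫*-+ (suc s) F G = trans (∫-cong (λ a → ∫*-+ s (F ∘ (a ∷_)) (G ∘ (a ∷_))))
          (∫-+ (λ a → ∫* s (F ∘ (a ∷_))) (λ a → ∫* s (G ∘ (a ∷_))))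

  ∫*-const : ∀ s k → ∫* s (λ _ → k) ≡ total ^ s * k
  ∫*-const zero    k = sym (+-identityʳ k)
  ∫*-const (suc s) k = begin
    ∫ (λ _ → ∫* s (λ _ → k)) ≡⟨ ∫-const _ ⟩
    total * ∫* s (λ _ → k)   ≡⟨ cong (total *_) (∫*-const s k) ⟩
    total * (total ^ s * k)  ≡⟨ *-assoc total (total ^ s) k ⟨
    total * total ^ s * k    ∎
    where open ≡-Reasoning

  ∫-∫*-swap : ∀ s (F : Fin n → Vec (Fin n) s → ℕ) → ∫ (λ a → ∫* s (F a)) ≡ ∫* s (λ p → ∫ (λ a → F a p))
  ∫-∫*-swap zero    F = refl
  ∫-∫*-swap (suc s) F =
    trans (∫-swap (λ a b → ∫* s (λ p → F a (b ∷ p)))) (∫-cong (λ b → ∫-∫*-swap s (λ a p → F a (b ∷ p))))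

-- Traces of a list on a sequence of sample points.

module Traces {V : Set} {n : ℕ} (h : Fin n → V → Bool) where

  select : Fin n → Bool → List V → List V
  select a true  = filterᵇ (h a)
  select a false = filterᵇ (not ∘ h a)

  filterᵇ-comm : ∀ (f g : V → Bool) B → filterᵇ f (filterᵇ g B) ≡ filterᵇ g (filterᵇ f B)
  filterᵇ-comm f g []       = refl
  filterᵇ-comm f g (x ∷ B) with f x in p | g x in q
  ... | true  | true  rewrite p | q = cong (x ∷_) (filterᵇ-comm f g B)
  ... | true  | false rewrite q     = filterᵇ-comm f g B
  ... | false | true  rewrite p     = filterᵇ-comm f g B
  ... | false | false               = filterᵇ-comm f g B

  select-comm : ∀ a b c d B → select a b (select c d B) ≡ select c d (select a b B)
  select-comm a true  c true  = filterᵇ-comm (h a) (h c)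
  select-comm a true  c false = filterᵇ-comm (h a) (not ∘ h c)
  select-comm a false c true  = filterᵇ-comm (not ∘ h a) (h c)
  select-comm a false c false = filterᵇ-comm (not ∘ h a) (not ∘ h c)

  select-AllPairs : ∀ a b {R : V → V → Set} {B} → AllPairs R B → AllPairs R (select a b B)
  select-AllPairs a true  = AllPairsₚ.filter⁺ (T? ∘ h a)
  select-AllPairs a false = AllPairsₚ.filter⁺ (T? ∘ not ∘ h a)

  length-select : ∀ a B → length (select a false B) + length (select a true B) ≡ length B
  length-select a []      = refl
  length-select a (x ∷ B) with h a x
  ... | true  = trans (+-suc _ _) (cong suc (length-select a B))
  ... | false = cong suc (length-select a B)

  -- The multiset of traces of `B` on the sample, to which the results on weighted cubes apply.
  weight : ∀ {s} → List V → Vec (Fin n) s → Vec Bool s → ℕ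
  weight B []      []      = length B
  weight B (a ∷ p) (b ∷ u) = weight (select a b B) p u

  size-weight : ∀ {s} B (p : Vec (Fin n) s) → size (weight B p) ≡ length B
  size-weight B []      = refl
  size-weight B (a ∷ p) =
    trans (cong₂ _+_ (size-weight (select a false B) p) (size-weight (select a true B) p)) (length-select a B)

  weight-select : ∀ {s} a B (p : Vec (Fin n) s) u →
    weight (select a false B) p u + weight (select a true B) p u ≡ weight B p u
  weight-select a B []      []      = length-select a B
  weight-select a B (c ∷ p) (d ∷ u)
    rewrite select-comm c d a false B | select-comm c d a true B = weight-select a (select c d B) p u

  support-≤ : ∀ {m} (u v w : Vec Bool m → ℕ) → (∀ t → u t + v t ≡ w t) → support w ≤ support u + support v
  support-≤ {zero}  u v w eq rewrite sym (eq []) = 1⊓-subadditive (u []) (v [])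
    where
    1⊓-subadditive : ∀ a b → 1 ⊓ (a + b) ≤ 1 ⊓ a + 1 ⊓ b
    1⊓-subadditive zero    b = ≤-refl
    1⊓-subadditive (suc a) b = s≤s z≤n
  support-≤ {suc m} u v w eq = begin
    support (w ∘ (false ∷_)) + support (w ∘ (true ∷_))
      ≤⟨ +-mono-≤ (support-≤ (u ∘ (false ∷_)) (v ∘ (false ∷_)) _ (eq ∘ (false ∷_)))
                  (support-≤ (u ∘ (true ∷_)) (v ∘ (true ∷_)) _ (eq ∘ (true ∷_))) ⟩
    (support (u ∘ (false ∷_)) + support (v ∘ (false ∷_))) + (support (u ∘ (true ∷_)) + support (v ∘ (true ∷_)))
      ≡⟨ +-interchange (support (u ∘ (false ∷_))) (support (v ∘ (false ∷_))) _ _ ⟩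
    _ ∎
    where open ≤-Reasoning

  -- A non-empty class of equal traces on `p` stays non-empty in at least one of the two halves into
  -- which `a` splits it.
  support-refine : ∀ {s} a B (p : Vec (Fin n) s) → support (weight B p) ≤ support (weight B (a ∷ p))
  support-refine a B p = support-≤ _ _ _ (weight-select a B p)

  disagreements : Fin n → V → List V → ℕ
  disagreements a x B = length (select a (not (h a x)) B)

  disagreements-∷ : ∀ a x y B → disagreements a x (y ∷ B) ≡ bit (h a x xor h a y) + disagreements a x B
  disagreements-∷ a x y B with h a x | h a y in eq
  ... | true  | true  rewrite eq = refl
  ... | true  | false rewrite eq = refl
  ... | false | true  rewrite eq = refl
  ... | false | false rewrite eq = refl

  -- The product counts the pairs separated by `a`; the new pairs are those that contain `x`.
  split-product-∷ : ∀ a x B → length (select a false (x ∷ B)) * length (select a true (x ∷ B))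
    ≡ length (select a false B) * length (select a true B) + disagreements a x B
  split-product-∷ a x B with h a x
  ... | true  = trans (*-suc (length (select a false B)) _) (+-comm (length (select a false B)) _)
  ... | false = +-comm (length (select a true B)) _

  module Packing (ω : Fin n → ℕ) where
    open Integral ω

    dist : V → V → ℕ
    dist x y = ∫ (λ a → bit (h a x xor h a y))

    Separated : ℕ → List V → Set
    Separated Δ = AllPairs (λ x y → Δ ≤ dist x y)

    ∫-disagreements : ∀ Δ x B → All (λ y → Δ ≤ dist x y) B → Δ * length B ≤ ∫ (λ a → disagreements a x B)
    ∫-disagreements Δ x []      []         = ≤-trans (≤-reflexive (*-zeroʳ Δ)) z≤n
    ∫-disagreements Δ x (y ∷ B) (far ∷ fs) = begin
      Δ * suc (length B)                                                   ≡⟨ *-suc Δ _ ⟩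
      Δ + Δ * length B                                                     ≤⟨ +-mono-≤ far (∫-disagreements Δ x B fs) ⟩
      dist x y + ∫ (λ a → disagreements a x B)                             ≡⟨ ∫-+ (λ a → bit (h a x xor h a y)) (λ a → disagreements a x B) ⟨
      ∫ (λ a → bit (h a x xor h a y) + disagreements a x B)                ≡⟨ ∫-cong (λ a → disagreements-∷ a x y B) ⟨
      ∫ (λ a → disagreements a x (y ∷ B))                                  ∎
      where open ≤-Reasoning

    -- Double counting of separated pairs: each of the `k * (k - 1) / 2` pairs contributes at least
    -- `Δ` to the integral. The form avoids division and subtraction.
    ∫-split-product : ∀ Δ B → Separated Δ B → Δ * (length B * length B)
      ≤ 2 * ∫ (λ a → length (select a false B) * length (select a true B)) + Δ * length B
    ∫-split-product Δ []      _          = ≤-trans (≤-reflexive (*-zeroʳ Δ)) z≤n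
    ∫-split-product Δ (x ∷ B) (far ∷ sep) = begin
      Δ * (suc k * suc k)
        ≡⟨ expand Δ k ⟩
      Δ * (k * k) + (2 * (Δ * k) + Δ)
        ≤⟨ +-mono-≤ (∫-split-product Δ B sep) (+-monoˡ-≤ Δ (*-monoʳ-≤ 2 (∫-disagreements Δ x B far))) ⟩
      2 * P + Δ * k + (2 * Q + Δ)
        ≡⟨ collect P Q Δ k ⟩
      2 * (P + Q) + Δ * suc k
        ≡⟨ cong (λ z → 2 * z + Δ * suc k) (∫-+ (λ a → length (select a false B) * length (select a true B)) (λ a → disagreements a x B)) ⟨
      2 * ∫ (λ a → length (select a false B) * length (select a true B) + disagreements a x B) + Δ * suc k
        ≡⟨ cong (λ z → 2 * z + Δ * suc k) (∫-cong (λ a → split-product-∷ a x B)) ⟨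
      2 * ∫ (λ a → length (select a false (x ∷ B)) * length (select a true (x ∷ B))) + Δ * suc k ∎
      where
      open ≤-Reasoning
      k = length B
      P = ∫ (λ a → length (select a false B) * length (select a true B))
      Q = ∫ (λ a → disagreements a x B)
      expand : ∀ Δ k → Δ * (suc k * suc k) ≡ Δ * (k * k) + (2 * (Δ * k) + Δ)
      expand = solve-∀
      collect : ∀ P Q Δ k → 2 * P + Δ * k + (2 * Q + Δ) ≡ 2 * (P + Q) + Δ * suc k
      collect = solve-∀

    *≤+*⊓ : ∀ a b → a * b ≤ (a + b) * (a ⊓ b)
    *≤+*⊓ a b with ≤-total a b
    ... | inj₁ a≤b rewrite m≤n⇒m⊓n≡m a≤b = begin
      a * b ≡⟨ *-comm a b ⟩
      b * a ≤⟨ *-monoˡ-≤ a (m≤n+m b a) ⟩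
      (a + b) * a ∎
      where open ≤-Reasoning
    ... | inj₂ b≤a rewrite m≥n⇒m⊓n≡n b≤a = *-monoˡ-≤ b (m≤m+n a b)

    -- The pair count is divided by `length B`, a product being at most the sum times the minimum.
    -- One `Δ` is lost if the list is non-empty; over all classes of equal traces these losses add
    -- up to `support`.
    ∫-split : ∀ Δ B → Separated Δ B →
      Δ * length B ≤ 2 * ∫ (λ a → length (select a false B) ⊓ length (select a true B)) + Δ * (1 ⊓ length B)
    ∫-split Δ []        _   = ≤-trans (≤-reflexive (*-zeroʳ Δ)) z≤n
    ∫-split Δ B@(_ ∷ _) sep = *-cancelˡ-≤ k (begin
      k * (Δ * k)
        ≡⟨ swap k Δ ⟩
      Δ * (k * k)
        ≤⟨ ∫-split-product Δ B sep ⟩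
      2 * ∫ (λ a → b₀ a * b₁ a) + Δ * k
        ≤⟨ +-monoˡ-≤ (Δ * k) (*-monoʳ-≤ 2 (∫-mono (λ a → *≤+*⊓ (b₀ a) (b₁ a)))) ⟩
      2 * ∫ (λ a → (b₀ a + b₁ a) * (b₀ a ⊓ b₁ a)) + Δ * k
        ≡⟨ cong (λ z → 2 * z + Δ * k) (∫-cong (λ a → cong (_* (b₀ a ⊓ b₁ a)) (length-select a B))) ⟩
      2 * ∫ (λ a → k * (b₀ a ⊓ b₁ a)) + Δ * k
        ≡⟨ cong (λ z → 2 * z + Δ * k) (∫-* k (λ a → b₀ a ⊓ b₁ a)) ⟩
      2 * (k * ∫ (λ a → b₀ a ⊓ b₁ a)) + Δ * k
        ≡⟨ factor k (∫ (λ a → b₀ a ⊓ b₁ a)) Δ ⟩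
      k * (2 * ∫ (λ a → b₀ a ⊓ b₁ a) + Δ * 1) ∎)
      where
      open ≤-Reasoning
      k = length B
      b₀ b₁ : Fin n → ℕ
      b₀ a = length (select a false B)
      b₁ a = length (select a true B)
      swap : ∀ k Δ → k * (Δ * k) ≡ Δ * (k * k)
      swap = solve-∀
      factor : ∀ k P Δ → 2 * (k * P) + Δ * k ≡ k * (2 * P + Δ * 1)
      factor = solve-∀

    -- The edges of the one-inclusion graph on `a ∷ p` in the direction of `a`.
    newEdges : ∀ {s} → List V → Vec (Fin n) s → Fin n → ℕ
    newEdges B p a = size (λ u → weight (select a false B) p u ⊓ weight (select a true B) p u)

    newEdges-∷ : ∀ {s} B c (p : Vec (Fin n) s) a →
      newEdges B (c ∷ p) a ≡ newEdges (select c false B) p a + newEdges (select c true B) p a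
    newEdges-∷ B c p a
      rewrite select-comm a false c false B | select-comm a true c false B
            | select-comm a false c true B | select-comm a true c true B = refl

    -- Each class of equal traces on `p` is still separated, so `∫-split` applies to every class and
    -- the results are added.
    ∫-newEdges : ∀ {s} Δ B (p : Vec (Fin n) s) → Separated Δ B →
      Δ * length B ≤ 2 * ∫ (newEdges B p) + Δ * support (weight B p)
    ∫-newEdges Δ B []      sep = ∫-split Δ B sep
    ∫-newEdges Δ B (c ∷ p) sep = begin
      Δ * length B
        ≡⟨ cong (Δ *_) (length-select c B) ⟨
      Δ * (length B₀ + length B₁)
        ≡⟨ *-distribˡ-+ Δ (length B₀) (length B₁) ⟩
      Δ * length B₀ + Δ * length B₁
        ≤⟨ +-mono-≤ (∫-newEdges Δ B₀ p (select-AllPairs c false sep)) (∫-newEdges Δ B₁ p (select-AllPairs c true sep)) ⟩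
      (2 * ∫ (newEdges B₀ p) + Δ * support (weight B₀ p)) + (2 * ∫ (newEdges B₁ p) + Δ * support (weight B₁ p))
        ≡⟨ collect (∫ (newEdges B₀ p)) (∫ (newEdges B₁ p)) Δ (support (weight B₀ p)) (support (weight B₁ p)) ⟩
      2 * (∫ (newEdges B₀ p) + ∫ (newEdges B₁ p)) + Δ * (support (weight B₀ p) + support (weight B₁ p))
        ≡⟨ cong (λ z → 2 * z + Δ * support (weight B (c ∷ p))) (trans (∫-cong (newEdges-∷ B c p)) (∫-+ (newEdges B₀ p) (newEdges B₁ p))) ⟨
      2 * ∫ (newEdges B (c ∷ p)) + Δ * support (weight B (c ∷ p)) ∎
      where
      open ≤-Reasoning
      B₀ = select c false B
      B₁ = select c true B
      collect : ∀ P Q Δ a b → (2 * P + Δ * a) + (2 * Q + Δ * b) ≡ 2 * (P + Q) + Δ * (a + b)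
      collect = solve-∀

    -- Induction on the sample size. The first point `a` splits `B` into two separated lists, whose
    -- edges are bounded by induction; the edges in the direction of `a` are bounded by
    -- `∫-newEdges`.
    ∫*-edges : ∀ s Δ B → Separated Δ B → total ^ s * (s * Δ * length B)
      ≤ ∫* s (λ p → 2 * total * edges (weight B p) + s * Δ * support (weight B p))
    ∫*-edges zero    Δ B sep = z≤n
    ∫*-edges (suc s) Δ B sep = begin
      W * W ^ s * (suc s * Δ * k)
        ≡⟨ split-suc W (W ^ s) s Δ k ⟩
      W * (W ^ s * (s * Δ * k)) + W ^ s * (W * (Δ * k))
        ≡⟨ cong₂ _+_ (∫-const _) (∫*-const s _) ⟨
      ∫ (λ _ → W ^ s * (s * Δ * k)) + ∫* s (λ _ → W * (Δ * k))
        ≤⟨ +-mono-≤ (∫-mono old) (∫*-mono s new) ⟩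
      ∫ (λ a → ∫* s (F (select a false B)) + ∫* s (F (select a true B))) + ∫* s (λ p → ∫ (λ a → N a p))
        -- New edges are averaged over `a` with the rest of the sample fixed, so the order of
        -- integration is exchanged.
        ≡⟨ cong (∫ (λ a → ∫* s (F (select a false B)) + ∫* s (F (select a true B))) +_) (∫-∫*-swap s N) ⟨
      ∫ (λ a → ∫* s (F (select a false B)) + ∫* s (F (select a true B))) + ∫ (λ a → ∫* s (N a))
        ≡⟨ ∫-+ (λ a → ∫* s (F (select a false B)) + ∫* s (F (select a true B))) (λ a → ∫* s (N a)) ⟨
      ∫ (λ a → ∫* s (F (select a false B)) + ∫* s (F (select a true B)) + ∫* s (N a))
        ≡⟨ ∫-cong (λ a → trans (∫*-+ s (λ p → F (select a false B) p + F (select a true B) p) (N a))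
                               (cong (_+ ∫* s (N a)) (∫*-+ s (F (select a false B)) (F (select a true B))))) ⟨
      ∫ (λ a → ∫* s (λ p → F (select a false B) p + F (select a true B) p + N a p))
        ≤⟨ ∫-mono (λ a → ∫*-mono s (pointwise a)) ⟩
      ∫ (λ a → ∫* s (λ p → 2 * W * edges (weight B (a ∷ p)) + suc s * Δ * support (weight B (a ∷ p)))) ∎
      where
      open ≤-Reasoning
      W = total
      k = length B
      F : List V → Vec (Fin n) s → ℕ
      F B p = 2 * W * edges (weight B p) + s * Δ * support (weight B p)
      N : Fin n → Vec (Fin n) s → ℕ
      N a p = 2 * W * newEdges B p a + Δ * support (weight B p)
      split-suc : ∀ W P s Δ k → W * P * (suc s * Δ * k) ≡ W * (P * (s * Δ * k)) + P * (W * (Δ * k))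
      split-suc = solve-∀
      old : ∀ a → W ^ s * (s * Δ * k) ≤ ∫* s (F (select a false B)) + ∫* s (F (select a true B))
      old a = begin
        W ^ s * (s * Δ * k)
          ≡⟨ cong (λ z → W ^ s * (s * Δ * z)) (length-select a B) ⟨
        W ^ s * (s * Δ * (length (select a false B) + length (select a true B)))
          ≡⟨ distrib (W ^ s) (s * Δ) (length (select a false B)) (length (select a true B)) ⟩
        W ^ s * (s * Δ * length (select a false B)) + W ^ s * (s * Δ * length (select a true B))
          ≤⟨ +-mono-≤ (∫*-edges s Δ (select a false B) (select-AllPairs a false sep))
                      (∫*-edges s Δ (select a true B) (select-AllPairs a true sep)) ⟩
        _ ∎
        where
        distrib : ∀ P q a b → P * (q * (a + b)) ≡ P * (q * a) + P * (q * b)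
        distrib = solve-∀
      new : ∀ p → W * (Δ * k) ≤ ∫ (λ a → N a p)
      new p = begin
        W * (Δ * k)
          ≤⟨ *-monoʳ-≤ W (∫-newEdges Δ B p sep) ⟩
        W * (2 * ∫ (newEdges B p) + Δ * support (weight B p))
          ≡⟨ distrib W (∫ (newEdges B p)) (Δ * support (weight B p)) ⟩
        2 * W * ∫ (newEdges B p) + W * (Δ * support (weight B p))
          ≡⟨ cong₂ _+_ (∫-* (2 * W) (newEdges B p)) (∫-const (Δ * support (weight B p))) ⟨
        ∫ (λ a → 2 * W * newEdges B p a) + ∫ (λ _ → Δ * support (weight B p))
          ≡⟨ ∫-+ (λ a → 2 * W * newEdges B p a) (λ _ → Δ * support (weight B p)) ⟨
        ∫ (λ a → N a p) ∎
        where
        distrib : ∀ W P q → W * (2 * P + q) ≡ 2 * W * P + W * q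
        distrib = solve-∀
      pointwise : ∀ a p → F (select a false B) p + F (select a true B) p + N a p
        ≤ 2 * W * edges (weight B (a ∷ p)) + suc s * Δ * support (weight B (a ∷ p))
      pointwise a p = begin
        F B₀ p + F B₁ p + (2 * W * newEdges B p a + Δ * support (weight B p))
          ≤⟨ +-monoʳ-≤ (F B₀ p + F B₁ p) (+-monoʳ-≤ (2 * W * newEdges B p a) (*-monoʳ-≤ Δ (support-refine a B p))) ⟩
        F B₀ p + F B₁ p + (2 * W * newEdges B p a + Δ * (support (weight B₀ p) + support (weight B₁ p)))
          ≡⟨ collect (2 * W) (edges (weight B₀ p)) (edges (weight B₁ p)) (newEdges B p a) s Δ (support (weight B₀ p)) (support (weight B₁ p)) ⟩
        2 * W * (edges (weight B₀ p) + edges (weight B₁ p) + newEdges B p a)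
          + suc s * Δ * (support (weight B₀ p) + support (weight B₁ p)) ∎
        where
        B₀ = select a false B
        B₁ = select a true B
        collect : ∀ W e f g s Δ x y → W * e + s * Δ * x + (W * f + s * Δ * y) + (W * g + Δ * (x + y))
          ≡ W * (e + f + g) + suc s * Δ * (x + y)
        collect = solve-∀

    -- Uniform upper bounds on edges and classes meet the averaged lower bound; the positive factor
    -- `total ^ s` then cancels.
    packing : ∀ s d c Δ B → Separated Δ B → 0 < total →
      (∀ (p : Vec (Fin n) s) → edges (weight B p) ≤ d * length B) →
      (∀ (p : Vec (Fin n) s) → support (weight B p) ≤ c) →
      s * Δ * length B ≤ 2 * total * (d * length B) + s * Δ * c
    packing s d c Δ B sep W>0 few-edges few-classes = *-cancelˡ-≤ (total ^ s) {{m^n≢0 total s {{>-nonZero W>0}}}} (begin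
      total ^ s * (s * Δ * length B)
        ≤⟨ ∫*-edges s Δ B sep ⟩
      ∫* s (λ p → 2 * total * edges (weight B p) + s * Δ * support (weight B p))
        ≤⟨ ∫*-mono s (λ p → +-mono-≤ (*-monoʳ-≤ (2 * total) (few-edges p)) (*-monoʳ-≤ (s * Δ) (few-classes p))) ⟩
      ∫* s (λ _ → 2 * total * (d * length B) + s * Δ * c)
        ≡⟨ ∫*-const s _ ⟩
      total ^ s * (2 * total * (d * length B) + s * Δ * c) ∎)
      where open ≤-Reasoning

-- Neighbourhood complexity of small classes

^-distribʳ-* : ∀ m n k → (m * n) ^ k ≡ m ^ k * n ^ k
^-distribʳ-* m n zero    = refl
^-distribʳ-* m n (suc k) rewrite ^-distribʳ-* m n k = interchange m n (m ^ k) (n ^ k)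
  where
  interchange : ∀ a b c d → a * b * (c * d) ≡ a * c * (b * d)
  interchange = solve-∀

n<2^n : ∀ n → n < 2 ^ n
n<2^n zero    = z<s
n<2^n (suc n) = begin-strict
  suc n         <⟨ s<s (n<2^n n) ⟩
  suc (2 ^ n)   ≤⟨ +-monoˡ-≤ (2 ^ n) (m^n>0 2 n) ⟩
  2 ^ n + 2 ^ n ≡⟨ cong (2 ^ n +_) (+-identityʳ _) ⟨
  2 ^ suc n     ∎
  where open ≤-Reasoning

n!≤n^n : ∀ n → n ! ≤ n ^ n
n!≤n^n zero    = ≤-refl
n!≤n^n (suc n) = *-monoʳ-≤ (suc n) (≤-trans (n!≤n^n n) (^-monoˡ-≤ n (n≤1+n n)))

funToFin-cong : ∀ {m n} {f g : Fin m → Fin n} → (∀ i → f i ≡ g i) → funToFin f ≡ funToFin g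
funToFin-cong {zero}  f≗g = refl
funToFin-cong {suc m} f≗g = cong₂ combine (f≗g zero) (funToFin-cong (f≗g ∘ suc))

finToFun-differ : ∀ {m n} {i j : Fin (n ^ m)} → i ≢ j → ∃[ k ] finToFun {n} {m} i k ≢ finToFun j k
finToFun-differ {m} {n} {i} {j} i≢j = ¬∀⟶∃¬ m _ (λ k → finToFun {n} i k ≟ finToFun j k) λ same →
  i≢j (trans (sym (funToFin-finToFin {m} i)) (trans (funToFin-cong same) (funToFin-finToFin {m} j)))

-- An injective sequence of length s, with Q choices available at every step.
spread : ∀ s {Q} → (Fin s → Fin Q) → Fin s → Fin (s + Q)
spread (suc s) φ zero    = suc s ↑ʳ φ zero
spread (suc s) φ (suc i) = punchIn (suc s ↑ʳ φ zero) (spread s (φ ∘ suc) i)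

spread-injective : ∀ s {Q} (φ : Fin s → Fin Q) → Injective _≡_ _≡_ (spread s φ)
spread-injective (suc s) φ {zero}  {zero}  eq = refl
spread-injective (suc s) φ {zero}  {suc j} eq = ⊥-elim (punchInᵢ≢i _ _ (sym eq))
spread-injective (suc s) φ {suc i} {zero}  eq = ⊥-elim (punchInᵢ≢i _ _ eq)
spread-injective (suc s) φ {suc i} {suc j} eq =
  cong suc (spread-injective s (φ ∘ suc) (punchIn-injective _ _ _ eq))

-- The choices can be read off one by one: equal first entries give equal first choices, hence the
-- same `punchIn`, which is undone on the remaining entries.
spread-differ : ∀ s {Q} {φ ψ : Fin s → Fin Q} → (∃[ i ] φ i ≢ ψ i) → ∃[ i ] spread s φ i ≢ spread s ψ i
spread-differ s {φ = φ} {ψ} (i , φi≢ψi) = ¬∀⟶∃¬ s _ (λ i → spread s φ i ≟ spread s ψ i) λ same →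
  φi≢ψi (cancel s φ ψ same i)
  where
  cancel : ∀ s {Q} (φ ψ : Fin s → Fin Q) → (∀ i → spread s φ i ≡ spread s ψ i) → ∀ i → φ i ≡ ψ i
  cancel (suc s) φ ψ same zero    = ↑ʳ-injective (suc s) _ _ (same zero)
  cancel (suc s) φ ψ same (suc i) = cancel s (φ ∘ suc) (ψ ∘ suc)
    (λ j → punchIn-injective (suc s ↑ʳ ψ zero) _ _
      (trans (cong (λ z → punchIn z (spread s (φ ∘ suc) j)) (sym (same zero))) (same (suc j)))) i

AllPairs-lookup : ∀ {A : Set} {R : A → A → Set} → Symmetric R → ∀ {xs} → AllPairs R xs →
  ∀ {i j} → i ≢ j → R (List.lookup xs i) (List.lookup xs j)
AllPairs-lookup R-sym (_  ∷ rs) {zero}  {zero}  i≢j = ⊥-elim (i≢j refl)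
AllPairs-lookup R-sym (rx ∷ rs) {zero}  {suc j} i≢j = All.lookup rx (∈-lookup j)
AllPairs-lookup R-sym (rx ∷ rs) {suc i} {zero}  i≢j = R-sym (All.lookup rx (∈-lookup i))
AllPairs-lookup R-sym (rx ∷ rs) {suc i} {suc j} i≢j = AllPairs-lookup R-sym rs (i≢j ∘ cong suc)

Unique-lookup-injective : ∀ {n} {xs : List (Fin n)} → Unique xs → Injective _≡_ _≡_ (List.lookup xs)
Unique-lookup-injective u {i} {j} eq with i ≟ j
... | yes i≡j = i≡j
... | no  i≢j = ⊥-elim (AllPairs-lookup (λ x≢y → x≢y ∘ sym) u i≢j eq)

Unique-⊆⇒length≤ : ∀ {n} {xs ys : List (Fin n)} → Unique xs → (∀ {x} → x ∈ xs → x ∈ ys) → length xs ≤ length ys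
Unique-⊆⇒length≤ {xs = xs} {ys} u sub = injective⇒≤ {f = position} λ {i} {j} eq → Unique-lookup-injective u (begin
  List.lookup xs i            ≡⟨ lookup-index (sub (∈-lookup i)) ⟩
  List.lookup ys (position i) ≡⟨ cong (List.lookup ys) eq ⟩
  List.lookup ys (position j) ≡⟨ lookup-index (sub (∈-lookup j)) ⟨
  List.lookup xs j            ∎)
  where
  open ≡-Reasoning
  position : Fin (length xs) → Fin (length ys)
  position i = Any.index (sub (∈-lookup {xs = xs} i))

length-filter-split : ∀ {A : Set} {P : Pred A 0ℓ} (P? : Decidable P) xs →
  length xs ≡ length (filter P? xs) + length (filter (¬? ∘ P?) xs)
length-filter-split P? [] = refl
length-filter-split P? (x ∷ xs) with P? x
... | yes _ = cong suc (length-filter-split P? xs)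
... | no  _ = trans (cong suc (length-filter-split P? xs)) (sym (+-suc _ _))

-- With `s = m * L`, the right side is at most `(2 * s * c) ^ (m + s)`. Since `s ≤ 2 ^ L`, the base
-- is at most `(4 * c) ^ L`, so the first `m` factors cost only `(4 * c) ^ s`, a constant per
-- sequence entry.
too-many-graphs : ∀ c .{{_ : NonZero c}} m .{{_ : NonZero m}} L .{{_ : NonZero L}} → m * L ≤ 2 ^ L →
  ¬ (suc (8 * (c * c)) * (m * L)) ^ (m * L) ≤ (m + m * L) ! * c ^ (m + m * L)
too-many-graphs c m L mL≤2^L many = <⇒≱ (^-monoˡ-< s {{m*n≢0 m L}} (*-monoˡ-< s {{m*n≢0 m L}} (n<1+n (8 * (c * c))))) (begin
  (suc (8 * (c * c)) * s) ^ s
    ≤⟨ many ⟩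
  (m + s) ! * c ^ (m + s)
    ≤⟨ *-monoˡ-≤ (c ^ (m + s)) (≤-trans (n!≤n^n (m + s)) (^-monoˡ-≤ (m + s) m+s≤2s)) ⟩
  (2 * s) ^ (m + s) * c ^ (m + s)
    ≡⟨ ^-distribʳ-* (2 * s) c (m + s) ⟨
  (2 * s * c) ^ (m + s)
    ≡⟨ ^-distribˡ-+-* (2 * s * c) m s ⟩
  (2 * s * c) ^ m * (2 * s * c) ^ s
    ≤⟨ *-monoˡ-≤ _ (^-monoˡ-≤ m 2sc≤[4c]^L) ⟩
  ((4 * c) ^ L) ^ m * (2 * s * c) ^ s
    ≡⟨ cong (_* (2 * s * c) ^ s) (trans (^-*-assoc (4 * c) L m) (cong ((4 * c) ^_) (*-comm L m))) ⟩
  (4 * c) ^ s * (2 * s * c) ^ s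
    ≡⟨ ^-distribʳ-* (4 * c) (2 * s * c) s ⟨
  (4 * c * (2 * s * c)) ^ s
    ≡⟨ cong (_^ s) (collect c s) ⟩
  (8 * (c * c) * s) ^ s ∎)
  where
  open ≤-Reasoning
  s = m * L
  collect : ∀ c s → 4 * c * (2 * s * c) ≡ 8 * (c * c) * s
  collect = solve-∀
  m+s≤2s : m + s ≤ 2 * s
  m+s≤2s = +-mono-≤ (m≤m*n m L) (m≤m+n s 0)
  m≤m^n : ∀ m n .{{_ : NonZero m}} .{{_ : NonZero n}} → m ≤ m ^ n
  m≤m^n m n = ≤-trans (≤-reflexive (sym (^-identityʳ m))) (^-monoʳ-≤ m (>-nonZero⁻¹ n))
  2sc≤[4c]^L : 2 * s * c ≤ (4 * c) ^ L
  2sc≤[4c]^L = begin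
    2 * s * c             ≤⟨ *-mono-≤ (*-mono-≤ (m≤m^n 2 L) mL≤2^L) (m≤m^n c L) ⟩
    2 ^ L * 2 ^ L * c ^ L ≡⟨ cong (_* c ^ L) (^-distribʳ-* 2 2 L) ⟨
    4 ^ L * c ^ L         ≡⟨ ^-distribʳ-* 4 c L ⟨
    (4 * c) ^ L           ∎

-- In multiples of `s`: one to discard the vertices of `A`, one to keep the sequences injective, and
-- `suc (8 * (suc c * suc c))` for the choices left at every step.
traceFactor : ℕ → ℕ
traceFactor c = 3 + 8 * (suc c * suc c)

module Neighbourhoods (𝒳 : GraphClass) (hereditary : Hereditary 𝒳)
  (c : ℕ) (small : ∀ n → CardX≤ 𝒳 n ((n !) * suc c ^ n))
  {n : ℕ} (G : Graph n) (G∈𝒳 : X 𝒳 n G) where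

  -- Every injective sequence in the image of `β`, appended to `α`, induces a labelled graph of the
  -- class. Its adjacencies to `α` reveal which vertex was chosen at each step, so different
  -- sequences give distinct graphs.
  count-subgraphs : ∀ {m s Q} (α : Fin m → Fin n) (β : Fin (s + Q) → Fin n) →
    Injective _≡_ _≡_ α → Injective _≡_ _≡_ β → (∀ i j → α i ≢ β j) →
    (∀ {i j} → i ≢ j → ∃[ l ] adj G (α l) (β i) ≢ adj G (α l) (β j)) →
    Q ^ s ≤ (m + s) ! * suc c ^ (m + s)
  count-subgraphs {m} {s} {Q} α β α-inj β-inj α≢β distinguish =
    subst (_≤ (m + s) ! * suc c ^ (m + s)) (length-tabulate sub)
      (small (m + s) (tabulate sub) (Allₚ.tabulate⁺ (λ k → hereditary G (embed k) (embed-injective k) G∈𝒳))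
        (AllPairsₚ.tabulate⁺ sub-distinct))
    where
    seq : Fin (Q ^ s) → Fin s → Fin (s + Q)
    seq k = spread s (finToFun {Q} {s} k)
    part : Fin (Q ^ s) → Fin m ⊎ Fin s → Fin n
    part k = [ α , β ∘ seq k ]′
    embed : Fin (Q ^ s) → Fin (m + s) → Fin n
    embed k x = part k (splitAt m x)
    part-injective : ∀ k → Injective _≡_ _≡_ (part k)
    part-injective k {inj₁ i} {inj₁ j} eq = cong inj₁ (α-inj eq)
    part-injective k {inj₁ i} {inj₂ j} eq = ⊥-elim (α≢β _ _ eq)
    part-injective k {inj₂ i} {inj₁ j} eq = ⊥-elim (α≢β _ _ (sym eq))
    part-injective k {inj₂ i} {inj₂ j} eq = cong inj₂ (spread-injective s _ (β-inj eq))
    embed-injective : ∀ k → Injective _≡_ _≡_ (embed k)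
    embed-injective k {x} {y} eq = trans (sym (join-splitAt m s x))
      (trans (cong [ _↑ˡ s , m ↑ʳ_ ]′ (part-injective k {splitAt m x} {splitAt m y} eq)) (join-splitAt m s y))
    sub : Fin (Q ^ s) → Graph (m + s)
    sub k = induced G (embed k) (embed-injective k)
    sub-distinct : ∀ {k l} → k ≢ l → Distinct (sub k) (sub l)
    sub-distinct {k} {l} k≢l with spread-differ s (finToFun-differ {s} {Q} k≢l)
    ... | i , differ with distinguish differ
    ...   | a , adj≢ = a ↑ˡ s , m ↑ʳ i , λ eq → adj≢ (trans (sym (embedded k)) (trans eq (embedded l)))
      where
      embedded : ∀ k → adj G (embed k (a ↑ˡ s)) (embed k (m ↑ʳ i)) ≡ adj G (α a) (β (seq k i))
      embedded k rewrite splitAt-↑ˡ m a s | splitAt-↑ʳ m s i = refl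

  K : ℕ
  K = traceFactor c

  DifferOn : List (Fin n) → Fin n → Fin n → Set
  DifferOn A x y = Any (λ a → adj G a x ≢ adj G a y) A

  DifferOn-sym : ∀ {A} → Symmetric (DifferOn A)
  DifferOn-sym = Any.map (_∘ sym)

  -- A longer `B` keeps at least `s + q * s` vertices after those of `A`, at most `m ≤ s` in number,
  -- are removed. The sequences drawn from them give more graphs than `too-many-graphs` permits.
  traces≤-unique : ∀ L .{{_ : NonZero L}} A → Unique A → .{{_ : NonZero (length A)}} → length A * L ≤ 2 ^ L →
    ∀ B → AllPairs (DifferOn A) B → length B ≤ K * (length A * L)
  traces≤-unique L A A! mL≤2^L B differ = ≮⇒≥ λ B-long →
    too-many-graphs (suc c) m L mL≤2^L
      (count-subgraphs (List.lookup A) (β B-long) (Unique-lookup-injective A!)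
        (λ eq → inject≤-injective _ _ _ _ (Unique-lookup-injective B′! eq))
        (λ i j eq → proj₂ (∈-filter⁻ (¬? ∘ (_∈? A)) {xs = B} (∈-lookup {xs = B′} (inject≤ j (enough B-long))))
          (subst (_∈ A) eq (∈-lookup i)))
        (λ {i} {j} i≢j → distinguish (AllPairs-lookup DifferOn-sym (AllPairsₚ.filter⁺ (¬? ∘ (_∈? A)) differ)
          (λ eq → i≢j (inject≤-injective _ _ i j eq)))))
    where
    open DecMembership (_≟_ {n}) using (_∈?_)
    open ≤-Reasoning
    m = length A
    s = m * L
    q = suc (8 * (suc c * suc c))
    B! : Unique B
    B! = AllPairs.map (λ d eq → let _ , _ , adj≢ = find d in adj≢ (cong (adj G _) eq)) differ
    B′ = filter (¬? ∘ (_∈? A)) B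
    B′! : Unique B′
    B′! = Uniqueₚ.filter⁺ (¬? ∘ (_∈? A)) B!
    enough : K * s < length B → s + q * s ≤ length B′
    enough B-long = +-cancelˡ-≤ s _ _ (begin
      s + (s + q * s)                       ≤⟨ <⇒≤ B-long ⟩
      length B                              ≡⟨ length-filter-split (_∈? A) B ⟩
      length (filter (_∈? A) B) + length B′ ≤⟨ +-monoˡ-≤ _ (Unique-⊆⇒length≤ (Uniqueₚ.filter⁺ (_∈? A) B!)
                                                 (λ x∈ → proj₂ (∈-filter⁻ (_∈? A) {xs = B} x∈))) ⟩
      m + length B′                         ≤⟨ +-monoˡ-≤ _ (m≤m*n m L) ⟩
      s + length B′                         ∎)
    β : K * s < length B → Fin (s + q * s) → Fin n
    β B-long j = List.lookup B′ (inject≤ j (enough B-long))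
    distinguish : ∀ {x y} → DifferOn A x y → ∃[ l ] adj G (List.lookup A l) x ≢ adj G (List.lookup A l) y
    distinguish d = Any.index d , lookup-index d

  -- Samples may repeat points. Removing repetitions keeps the traces distinct and only shortens the
  -- sample.
  traces≤ : ∀ L .{{_ : NonZero L}} A → .{{_ : NonZero (length A)}} → length A * L ≤ 2 ^ L →
    ∀ B → AllPairs (DifferOn A) B → length B ≤ K * (length A * L)
  traces≤ L A@(_ ∷ _) mL≤2^L B differ = ≤-trans
    (traces≤-unique L A′ (deduplicate-! _≟_ A) (≤-trans (*-monoˡ-≤ L shorter) mL≤2^L) B
      (AllPairs.map (λ d → let a , a∈A , adj≢ = find d in lose (∈-deduplicate⁺ _≟_ a∈A) adj≢) differ))
    (*-monoʳ-≤ K (*-monoˡ-≤ L shorter))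
    where
    A′ = deduplicate _≟_ A
    shorter : length A′ ≤ length A
    shorter = Unique-⊆⇒length≤ (deduplicate-! _≟_ A) (∈-deduplicate⁻ _≟_ A)

  open Traces (adj G)

  ∈-select⁻ : ∀ a b {x B} → x ∈ select a b B → x ∈ B × adj G a x ≡ b
  ∈-select⁻ a true  {B = B} x∈ = let x∈B , t = ∈-filter⁻ (T? ∘ adj G a) {xs = B} x∈ in x∈B , Equivalence.to T-≡ t
  ∈-select⁻ a false {B = B} x∈ = let x∈B , t = ∈-filter⁻ (T? ∘ not ∘ adj G a) {xs = B} x∈ in x∈B , Equivalence.to T-not-≡ t

  weight-positive : ∀ {s} B (p : Vec (Fin n) s) u → 0 < weight B p u →
    ∃[ x ] (x ∈ B × (∀ i → adj G (lookup p i) x ≡ lookup u i))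
  weight-positive []      []      []      ()
  weight-positive (x ∷ B) []      []      _   = x , here refl , λ ()
  weight-positive B       (a ∷ p) (b ∷ u) pos =
    let x , x∈ , eq = weight-positive (select a b B) p u pos
        x∈B , adj≡b = ∈-select⁻ a b x∈
    in x , x∈B , λ { zero → adj≡b ; (suc i) → eq i }

  -- Choosing one vertex from each non-empty class turns `support` into the length of a list to
  -- which `traces≤` applies.
  representatives : ∀ {s} B (p : Vec (Fin n) s) →
    ∃[ R ] (length R ≡ support (weight B p) × All (_∈ B) R × AllPairs (DifferOn (toList p)) R)
  representatives []      []      = [] , refl , [] , []
  representatives (x ∷ B) []      = x ∷ [] , refl , here refl ∷ [] , [] ∷ []
  representatives B       (a ∷ p) =
    let R₀ , len₀ , sub₀ , ap₀ = representatives (select a false B) p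
        R₁ , len₁ , sub₁ , ap₁ = representatives (select a true B) p
    in R₀ ++ R₁
     , trans (length-++ R₀) (cong₂ _+_ len₀ len₁)
     , Allₚ.++⁺ (All.map (proj₁ ∘ ∈-select⁻ a false {B = B}) sub₀) (All.map (proj₁ ∘ ∈-select⁻ a true {B = B}) sub₁)
     , AllPairsₚ.++⁺ (AllPairs.map there ap₀) (AllPairs.map there ap₁)
         (All.map (λ x∈ → All.map (λ y∈ → here λ eq →
            contradiction (trans (sym (proj₂ (∈-select⁻ a false {B = B} x∈))) (trans eq (proj₂ (∈-select⁻ a true {B = B} y∈)))) λ ()) sub₁) sub₀)

  support≤ : ∀ L .{{_ : NonZero L}} {s} .{{_ : NonZero s}} → s * L ≤ 2 ^ L → ∀ B (p : Vec (Fin n) s) →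
    support (weight B p) ≤ K * (s * L)
  support≤ L {s} sL≤2^L B p =
    let R , len , _ , differ = representatives B p
    in subst₂ (λ r m → r ≤ K * (m * L)) len (length-toList p)
         (traces≤ L (toList p) {{subst NonZero (sym (length-toList p)) it}}
           (subst (λ m → m * L ≤ 2 ^ L) (sym (length-toList p)) sL≤2^L) R differ)

  -- A shattered set of `d` points has `2 ^ d` traces, against the bound of `traces≤` with `L = d`.
  ¬shatters : ∀ d .{{_ : NonZero d}} → K * (d * d) < 2 ^ d → ∀ {s} B (p : Vec (Fin n) s) → ¬ Shatters (weight B p) d
  ¬shatters d Kd²<2^d B p (pos , shat) = <⇒≱ Kd²<2^d
    (subst₂ (λ b a → b ≤ K * (a * d)) (length-tabulate witness) (length-tabulate points)
      (traces≤ d (tabulate points) {{subst NonZero (sym (length-tabulate points)) it}}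
        (subst (λ m → m * d ≤ 2 ^ d) (sym (length-tabulate points)) (≤-trans (m≤n*m (d * d) K) (<⇒≤ Kd²<2^d)))
        (tabulate witness)
        (AllPairsₚ.tabulate⁺ λ i≢j → let l , differ = finToFun-differ {d} {2} i≢j in
          lose (∈-tabulate⁺ l) (λ eq → differ (toBool-injective
            (trans (sym (witness-adj _ l)) (trans eq (witness-adj _ l))))))))
    where
    toBool : Fin 2 → Bool
    toBool zero    = false
    toBool (suc _) = true
    toBool-injective : ∀ {i j} → toBool i ≡ toBool j → i ≡ j
    toBool-injective {zero}     {zero}     _ = refl
    toBool-injective {suc zero} {suc zero} _ = refl
    points : Fin d → Fin n
    points i = lookup p (pos i)
    realised : (k : Fin (2 ^ d)) → ∃[ x ] (∀ i → adj G (points i) x ≡ toBool (finToFun {2} {d} k i))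
    realised k =
      let u , positive , u≡ = shat (toBool ∘ finToFun {2} {d} k)
          x , _ , x≡ = weight-positive B p u positive
      in x , λ i → trans (x≡ (pos i)) (u≡ i)
    witness : Fin (2 ^ d) → Fin n
    witness = proj₁ ∘ realised
    witness-adj : ∀ k i → adj G (points i) (witness k) ≡ toBool (finToFun {2} {d} k i)
    witness-adj k = proj₂ (realised k)

-- Orders with few alternations

-- `rest` serves as `B` with one entry `x` taken out; `y` remains in it to mark where `x` is put
-- back.
record Pair {V : Set} (R : V → V → Set) (B : List V) : Set where
  field
    x y     : V
    rest    : List V
    cover   : ∀ {z} → z ∈ B → z ≡ x ⊎ z ∈ rest
    length≡ : length B ≡ suc (length rest)
    y∈rest  : y ∈ rest
    related : R x y

find-pair : ∀ {V : Set} {R : V → V → Set} → (∀ x y → Dec (R x y)) → ∀ B →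
  AllPairs (λ x y → ¬ R x y) B ⊎ Pair R B
find-pair R? []      = inj₁ []
find-pair R? (x ∷ B) with Any.any? (R? x) B
... | yes any = let y , y∈B , r = find any in inj₂ record
  { x = x ; y = y ; rest = B
  ; cover = λ { (here eq) → inj₁ eq ; (there z∈) → inj₂ z∈ }
  ; length≡ = refl ; y∈rest = y∈B ; related = r }
... | no ¬any with find-pair R? B
...   | inj₁ none = inj₁ (Allₚ.¬Any⇒All¬ B ¬any ∷ none)
...   | inj₂ p    = inj₂ record
  { x = Pair.x p ; y = Pair.y p ; rest = x ∷ Pair.rest p
  ; cover = λ { (here eq) → inj₂ (here eq) ; (there z∈) → Sum.map₂ there (Pair.cover p z∈) }
  ; length≡ = cong suc (Pair.length≡ p) ; y∈rest = there (Pair.y∈rest p) ; related = Pair.related p }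

changes : {V : Set} → (V → Bool) → Bool → List V → ℕ
changes f b []       = 0
changes f b (x ∷ xs) = bit (b xor f x) + changes f (f x) xs

insertAfter : {V : Set} → V → {y : V} {xs : List V} → y ∈ xs → List V
insertAfter x {xs = y ∷ xs} (here _)  = y ∷ x ∷ xs
insertAfter x {xs = y ∷ xs} (there p) = y ∷ insertAfter x p

length-insertAfter : ∀ {V : Set} (x : V) {y xs} (p : y ∈ xs) → length (insertAfter x p) ≡ suc (length xs)
length-insertAfter x (here _)  = refl
length-insertAfter x (there p) = cong suc (length-insertAfter x p)

∈-insertAfter-new : ∀ {V : Set} (x : V) {y xs} (p : y ∈ xs) → x ∈ insertAfter x p
∈-insertAfter-new x (here _)  = there (here refl)
∈-insertAfter-new x (there p) = there (∈-insertAfter-new x p)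

∈-insertAfter-old : ∀ {V : Set} (x : V) {y z xs} (p : y ∈ xs) → z ∈ xs → z ∈ insertAfter x p
∈-insertAfter-old x (here _)  (here eq) = here eq
∈-insertAfter-old x (here _)  (there q) = there (there q)
∈-insertAfter-old x (there p) (here eq) = here eq
∈-insertAfter-old x (there p) (there q) = there (∈-insertAfter-old x p q)

xor-triangle : ∀ a b c → bit (a xor c) ≤ bit (a xor b) + bit (b xor c)
xor-triangle false false c     = ≤-refl
xor-triangle true  true  c     = ≤-refl
xor-triangle false true  false = z≤n
xor-triangle false true  true  = ≤-refl
xor-triangle true  false false = ≤-refl
xor-triangle true  false true  = z≤n

xor-bit-comm : ∀ a b → bit (a xor b) ≡ bit (b xor a)
xor-bit-comm false false = refl
xor-bit-comm false true  = refl
xor-bit-comm true  false = refl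
xor-bit-comm true  true  = refl

changes-start : ∀ {V : Set} (f : V → Bool) a b xs → changes f a xs ≤ bit (a xor b) + changes f b xs
changes-start f a b []       = z≤n
changes-start f a b (x ∷ xs) = begin
  bit (a xor f x) + changes f (f x) xs                     ≤⟨ +-monoˡ-≤ _ (xor-triangle a b (f x)) ⟩
  bit (a xor b) + bit (b xor f x) + changes f (f x) xs     ≡⟨ +-assoc (bit (a xor b)) _ _ ⟩
  bit (a xor b) + (bit (b xor f x) + changes f (f x) xs)   ∎
  where open ≤-Reasoning

-- Next to an element with the same value, `x` goes unnoticed; otherwise it adds at most one
-- alternation on either side.
changes-insertAfter : ∀ {V : Set} (f : V → Bool) b (x : V) {y xs} (p : y ∈ xs) →
  changes f b (insertAfter x p) ≤ 2 * bit (f x xor f y) + changes f b xs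
changes-insertAfter f b x {y} {_ ∷ xs} (here refl) = begin
  bit (b xor f y) + (bit (f y xor f x) + changes f (f x) xs)
    ≤⟨ +-monoʳ-≤ (bit (b xor f y)) (+-mono-≤ (≤-reflexive (xor-bit-comm (f y) (f x))) (changes-start f (f x) (f y) xs)) ⟩
  bit (b xor f y) + (bit (f x xor f y) + (bit (f x xor f y) + changes f (f y) xs))
    ≡⟨ collect (bit (b xor f y)) (bit (f x xor f y)) _ ⟩
  2 * bit (f x xor f y) + (bit (b xor f y) + changes f (f y) xs) ∎
  where
  open ≤-Reasoning
  collect : ∀ a d r → a + (d + (d + r)) ≡ 2 * d + (a + r)
  collect = solve-∀
changes-insertAfter f b x {y} {z ∷ xs} (there p) = begin
  bit (b xor f z) + changes f (f z) (insertAfter x p)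
    ≤⟨ +-monoʳ-≤ (bit (b xor f z)) (changes-insertAfter f (f z) x p) ⟩
  bit (b xor f z) + (2 * bit (f x xor f y) + changes f (f z) xs)
    ≡⟨ collect (bit (b xor f z)) (2 * bit (f x xor f y)) _ ⟩
  2 * bit (f x xor f y) + (bit (b xor f z) + changes f (f z) xs) ∎
  where
  open ≤-Reasoning
  collect : ∀ a d r → a + (d + r) ≡ d + (a + r)
  collect = solve-∀

module Reweighting {V : Set} {n : ℕ} (h : Fin n → V → Bool) (D N : ℕ) where
  open Traces h
  open Packing using (dist)

  Close : (Fin n → ℕ) → ℕ → V → V → Set
  Close ω k x y = k * dist ω x y ≤ D * sum ω

  -- `cross a` is the number of times that the weight of `a` is doubled. Its final weight is at most
  -- the final total, which has grown by the product of the factors `1 + D / k`; `bounded` writes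
  -- this product with factorials, dropping a divisor `D !`.
  record Order (B : List V) (ω : Fin n → ℕ) : Set where
    field
      list    : List V
      cover   : ∀ {z} → z ∈ B → z ∈ list
      length≡ : length list ≡ length B
      cross   : Fin n → ℕ
      few     : ∀ a → changes (h a) false list ≤ suc (2 * cross a)
      bounded : ∀ a → length B ! * (ω a * 2 ^ cross a) ≤ sum ω * (length B + D) !

  reweight : (Fin n → ℕ) → V → V → Fin n → ℕ
  reweight ω x y a = ω a + ω a * bit (h a x xor h a y)

  -- The points separating x from y double their weight, so that a point
  -- crossed often by the order becomes heavy, while the total weight grows
  -- only by the factor 1 + D / k at the step with k elements left.
  extend : ∀ {B ω} (p : Pair (Close ω (length B)) B) →
    Order (Pair.rest p) (reweight ω (Pair.x p) (Pair.y p)) → Order B ω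
  extend {B} {ω} p sub = record
    { list    = insertAfter x y∈list
    ; cover   = λ z∈B → [ (λ { refl → ∈-insertAfter-new x y∈list })
                        , (λ z∈rest → ∈-insertAfter-old x y∈list (Order.cover sub z∈rest)) ]′ (cover z∈B)
    ; length≡ = trans (length-insertAfter x y∈list) (trans (cong suc (Order.length≡ sub)) (sym length≡))
    ; cross   = λ a → differ a + cross a
    ; few     = few-insert
    ; bounded = bounded-insert
    }
    where
    open Pair p
    open Order sub using (list; cross; few; bounded)
    open ≤-Reasoning
    k = length rest
    ω′ = reweight ω x y
    y∈list = Order.cover sub y∈rest
    differ : Fin n → ℕ
    differ a = bit (h a x xor h a y)
    few-insert : ∀ a → changes (h a) false (insertAfter x y∈list) ≤ suc (2 * (differ a + cross a))
    few-insert a = begin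
      changes (h a) false (insertAfter x y∈list) ≤⟨ changes-insertAfter (h a) false x y∈list ⟩
      2 * differ a + changes (h a) false list    ≤⟨ +-monoʳ-≤ (2 * differ a) (few a) ⟩
      2 * differ a + suc (2 * cross a)           ≡⟨ collect (differ a) (cross a) ⟩
      suc (2 * (differ a + cross a))             ∎
      where
      collect : ∀ d c → 2 * d + suc (2 * c) ≡ suc (2 * (d + c))
      collect = solve-∀
    double : ∀ w b c → w * 2 ^ (bit b + c) ≡ (w + w * bit b) * 2 ^ c
    double w false c rewrite *-zeroʳ w | +-identityʳ w = refl
    double w true  c = collect w (2 ^ c)
      where
      collect : ∀ w p → w * (2 * p) ≡ (w + w * 1) * p
      collect = solve-∀
    growth : suc k * sum ω′ ≤ (suc k + D) * sum ω
    growth = begin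
      suc k * sum ω′                     ≡⟨ cong (suc k *_) (∑-distrib-+ ω (λ a → ω a * differ a)) ⟩
      suc k * (sum ω + dist ω x y)       ≡⟨ *-distribˡ-+ (suc k) (sum ω) (dist ω x y) ⟩
      suc k * sum ω + suc k * dist ω x y ≤⟨ +-monoʳ-≤ (suc k * sum ω) (subst (λ l → Close ω l x y) length≡ related) ⟩
      suc k * sum ω + D * sum ω          ≡⟨ *-distribʳ-+ (sum ω) (suc k) D ⟨
      (suc k + D) * sum ω                ∎
    bounded-insert : ∀ a → length B ! * (ω a * 2 ^ (differ a + cross a)) ≤ sum ω * (length B + D) !
    bounded-insert a = subst (λ l → l ! * (ω a * 2 ^ (differ a + cross a)) ≤ sum ω * (l + D) !) (sym length≡) (begin
      suc k * k ! * (ω a * 2 ^ (differ a + cross a)) ≡⟨ cong (suc k * k ! *_) (double (ω a) (h a x xor h a y) (cross a)) ⟩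
      suc k * k ! * (ω′ a * 2 ^ cross a)             ≡⟨ *-assoc (suc k) (k !) _ ⟩
      suc k * (k ! * (ω′ a * 2 ^ cross a))           ≤⟨ *-monoʳ-≤ (suc k) (bounded a) ⟩
      suc k * (sum ω′ * (k + D) !)                   ≡⟨ *-assoc (suc k) (sum ω′) _ ⟨
      suc k * sum ω′ * (k + D) !                     ≤⟨ *-monoˡ-≤ ((k + D) !) growth ⟩
      (suc k + D) * sum ω * (k + D) !                ≡⟨ rearrange (suc k + D) (sum ω) ((k + D) !) ⟩
      sum ω * (suc k + D) !                          ∎)
      where
      rearrange : ∀ a b c → a * b * c ≡ b * (a * c)
      rearrange = solve-∀

  singleton-bounded : ∀ (ω : Fin n → ℕ) k a → 1 * (ω a * 1) ≤ sum ω * k !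
  singleton-bounded ω k a = ≤-trans (≤-reflexive (*-identityˡ _)) (*-mono-≤ (term≤sum ω a) (1≤n! k))

  module _ (close-pair : ∀ ω B → 2 ≤ length B → length B ≤ N → Pair (Close ω (length B)) B) where

    order : ∀ k B → length B ≡ k → k ≤ N → ∀ ω → Order B ω
    order zero       []          _ _ ω = record
      { list = [] ; cover = λ z∈ → z∈ ; length≡ = refl ; cross = λ _ → 0
      ; few = λ _ → z≤n ; bounded = singleton-bounded ω D }
    -- A single vertex has no partner. Its one possible alternation is the `suc` in `few`.
    order (suc zero) B@(x ∷ []) _ _ ω = record
      { list = B ; cover = λ z∈ → z∈ ; length≡ = refl ; cross = λ _ → 0
      ; few = λ a → ≤-trans (≤-reflexive (+-identityʳ _)) (bit≤1 (h a x))
      ; bounded = singleton-bounded ω (suc D) }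
    order (suc k@(suc _)) B eq k<N ω =
      extend pair (order k (Pair.rest pair) (suc-injective (trans (sym (Pair.length≡ pair)) eq)) (<⇒≤ k<N) _)
      where
      pair = close-pair ω B (subst (2 ≤_) (sym eq) (s≤s (s≤s z≤n))) (subst (_≤ N) (sym eq) k<N)

-- As `d` is a power of two, exponents can be compared: on the left the exponent is at most
-- `K + 2 * (4 + K)`, linear in `K`, on the right it is `d`.
vc-constant : ∀ K → let d = 2 ^ (4 + K) in K * (d * d) < 2 ^ d
vc-constant K = begin-strict
  K * (d * d)             <⟨ *-monoˡ-< (d * d) {{m*n≢0 d d {{m^n≢0 2 j}} {{m^n≢0 2 j}}}} (n<2^n K) ⟩
  2 ^ K * (d * d)         ≡⟨ cong (2 ^ K *_) (^-distribˡ-+-* 2 j j) ⟨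
  2 ^ K * 2 ^ (j + j)     ≡⟨ ^-distribˡ-+-* 2 K (j + j) ⟨
  2 ^ (K + (j + j))       ≤⟨ ^-monoʳ-≤ 2 exponent ⟩
  2 ^ d                   ∎
  where
  open ≤-Reasoning
  j = 4 + K
  d = 2 ^ j
  exponent : K + (j + j) ≤ d
  exponent = begin
    K + (j + j)             ≤⟨ m≤m+n _ (8 + 13 * K) ⟩
    K + (j + j) + (8 + 13 * K) ≡⟨ collect K ⟩
    16 * suc K              ≤⟨ *-monoʳ-≤ 16 (n<2^n K) ⟩
    16 * 2 ^ K              ≡⟨ ^-distribˡ-+-* 2 4 K ⟨
    d                       ∎
    where
    collect : ∀ K → K + ((4 + K) + (4 + K)) + (8 + 13 * K) ≡ 16 * suc K
    collect = solve-∀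

-- Close pairs from the packing bound.

module ClosePairs {V : Set} {n : ℕ} (h : Fin n → V → Bool) (N K d L : ℕ)
  .{{_ : NonZero K}} .{{_ : NonZero d}} .{{_ : NonZero L}} (N≤2^L : N ≤ 2 ^ L)
  (few-edges : ∀ {s} B (p : Vec (Fin n) s) → edges (Traces.weight h B p) ≤ d * length B)
  (few-traces : ∀ {s} .{{_ : NonZero s}} → s * L ≤ 2 ^ L →
    ∀ B (p : Vec (Fin n) s) → support (Traces.weight h B p) ≤ K * (s * L))
  where

  open Traces h
  open Packing using (dist; packing)

  -- The product of `4 * d`, from the packing bound, and `4 * K * L`, which bounds the ratio of list
  -- length to sample size.
  D : ℕ
  D = 16 * d * K * L

  open Reweighting h D N

  dist≤total : ∀ ω x y → dist ω x y ≤ sum ω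
  dist≤total ω x y = sum-mono λ a → ≤-trans (*-monoʳ-≤ (ω a) (bit≤1 (h a x xor h a y))) (≤-reflexive (*-identityʳ (ω a)))

  dist-scale : ∀ k ω x y → dist (λ a → k * ω a) x y ≡ k * dist ω x y
  dist-scale k ω x y = trans (sum-cong-≗ (λ a → *-assoc k (ω a) _)) (sym (*-distribˡ-sum k (λ a → ω a * bit (h a x xor h a y))))

  ¬all-far : ∀ ω B → 2 ≤ length B → length B ≤ N → ¬ AllPairs (λ x y → ¬ Close ω (length B) x y) B
  ¬all-far ω (_ ∷ []) (s≤s ()) _ _
  ¬all-far ω B@(x ∷ y ∷ _) _ k≤N far@((x-y-far ∷ _) ∷ _) with length B ≤? D
  -- In a short list any two elements are close, as no distance exceeds the total weight.
  ... | yes k≤D = x-y-far (*-mono-≤ k≤D (dist≤total ω x y))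
  ... | no  k≰D = <⇒≱ (*-monoʳ-< s (n<1+n (D * W))) (begin
    s * Δ                     ≤⟨ *-cancelˡ-≤ k bound ⟩
    4 * W * d * k             ≤⟨ *-monoʳ-≤ (4 * W * d) k≤4KLs ⟩
    4 * W * d * (4 * K * L * s) ≡⟨ collect W d K L s ⟩
    s * (D * W)               ∎)
    where
    open ≤-Reasoning
    k = length B
    W = sum ω
    Δ = suc (D * W)
    instance
      2KL≢0 : NonZero (2 * K * L)
      2KL≢0 = m*n≢0 (2 * K) L {{m*n≢0 2 K}}
    2KL≤D : 2 * K * L ≤ D
    2KL≤D = *-monoˡ-≤ L (*-monoˡ-≤ K (≤-trans (m≤n*m 2 (8 * d) {{m*n≢0 8 d}}) (≤-reflexive (eq d))))
      where
      eq : ∀ d → 8 * d * 2 ≡ 16 * d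
      eq = solve-∀
    -- The sample size is chosen so that there are at most `k / 2` traces; the trace term of the
    -- packing bound then takes up at most half of the left side.
    s = k / (2 * K * L)
    s>0 : 0 < s
    s>0 = m≥n⇒m/n>0 (≤-trans 2KL≤D (<⇒≤ (≰⇒> k≰D)))
    instance
      s≢0 : NonZero s
      s≢0 = >-nonZero s>0
    s*2KL≤k : s * (2 * K * L) ≤ k
    s*2KL≤k = m/n*n≤m k (2 * K * L)
    k≤4KLs : k ≤ 4 * K * L * s
    k≤4KLs = begin
      k                                       ≡⟨ m≡m%n+[m/n]*n k (2 * K * L) ⟩
      k % (2 * K * L) + s * (2 * K * L)       ≤⟨ +-monoˡ-≤ _ (<⇒≤ (m%n<n k (2 * K * L))) ⟩
      2 * K * L + s * (2 * K * L)             ≤⟨ +-monoˡ-≤ _ (m≤n*m (2 * K * L) s) ⟩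
      s * (2 * K * L) + s * (2 * K * L)       ≡⟨ eq K L s ⟩
      4 * K * L * s                           ∎
      where
      eq : ∀ K L s → s * (2 * K * L) + s * (2 * K * L) ≡ 4 * K * L * s
      eq = solve-∀
    sL≤2^L : s * L ≤ 2 ^ L
    sL≤2^L = begin
      s * L           ≤⟨ *-monoʳ-≤ s (m≤n*m L (2 * K) {{m*n≢0 2 K}}) ⟩
      s * (2 * K * L) ≤⟨ s*2KL≤k ⟩
      k               ≤⟨ k≤N ⟩
      N               ≤⟨ N≤2^L ⟩
      2 ^ L           ∎
    -- Scaling the weights by `k` makes the threshold `D * W / k` an integer. The `suc` in `Δ`
    -- records strict separation and yields the contradiction.
    kω : Fin n → ℕ
    kω a = k * ω a
    far′ : ∀ {x y} → ¬ Close ω k x y → Δ ≤ dist kω x y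
    far′ {x} {y} ¬close = ≤-trans (≰⇒> ¬close) (≤-reflexive (sym (dist-scale k ω x y)))
    collect : ∀ W d K L s → 4 * W * d * (4 * K * L * s) ≡ s * (16 * d * K * L * W)
    collect = solve-∀
    bound : k * (s * Δ) ≤ k * (4 * W * d * k)
    bound = +-cancelʳ-≤ (s * Δ * k) _ _ (begin
      k * (s * Δ) + s * Δ * k
        ≡⟨ eq₁ k (s * Δ) ⟩
      2 * (s * Δ * k)
        ≤⟨ *-monoʳ-≤ 2 (packing kω s d (K * (s * L)) Δ B (AllPairs.map far′ far)
             (≤-trans (≤-trans z<s (far′ x-y-far)) (dist≤total kω x y)) (few-edges B) (few-traces sL≤2^L B)) ⟩
      2 * (2 * sum kω * (d * k) + s * Δ * (K * (s * L)))
        ≡⟨ cong (λ z → 2 * (2 * z * (d * k) + s * Δ * (K * (s * L)))) (sym (*-distribˡ-sum k ω)) ⟩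
      2 * (2 * (k * W) * (d * k) + s * Δ * (K * (s * L)))
        ≡⟨ eq₂ k W d (s * Δ) K s L ⟩
      k * (4 * W * d * k) + s * Δ * (s * (2 * K * L))
        ≤⟨ +-monoʳ-≤ (k * (4 * W * d * k)) (*-monoʳ-≤ (s * Δ) s*2KL≤k) ⟩
      k * (4 * W * d * k) + s * Δ * k ∎)
      where
      eq₁ : ∀ k t → k * t + t * k ≡ 2 * (t * k)
      eq₁ = solve-∀
      eq₂ : ∀ k W d t K s L → 2 * (2 * (k * W) * (d * k) + t * (K * (s * L))) ≡ k * (4 * W * d * k) + t * (s * (2 * K * L))
      eq₂ = solve-∀

  close-pair : ∀ ω B → 2 ≤ length B → length B ≤ N → Pair (Close ω (length B)) B
  close-pair ω B 2≤k k≤N with find-pair (λ x y → length B * dist ω x y ≤? D * sum ω) B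
  ... | inj₁ far  = ⊥-elim (¬all-far ω B 2≤k k≤N far)
  ... | inj₂ pair = pair

-- Labels

bits : ℕ → ℕ → List Bool
bits zero    m = []
bits (suc L) m with 2 ^ L ≤? m
... | yes _ = true ∷ bits L (m ∸ 2 ^ L)
... | no  _ = false ∷ bits L m

value : List Bool → ℕ
value []       = 0
value (b ∷ bs) = bit b * 2 ^ length bs + value bs

length-bits : ∀ L m → length (bits L m) ≡ L
length-bits zero    m = refl
length-bits (suc L) m with 2 ^ L ≤? m
... | yes _ = cong suc (length-bits L _)
... | no  _ = cong suc (length-bits L m)

value-bits : ∀ L {m} → m < 2 ^ L → value (bits L m) ≡ m
value-bits zero    (s≤s z≤n) = refl
value-bits (suc L) {m} m<2^L with 2 ^ L ≤? m
... | no  2^L≰m = value-bits L (≰⇒> 2^L≰m)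
... | yes 2^L≤m rewrite length-bits L (m ∸ 2 ^ L) | +-identityʳ (2 ^ L) = begin
  2 ^ L + value (bits L (m ∸ 2 ^ L)) ≡⟨ cong (2 ^ L +_) (value-bits L (+-cancelˡ-< (2 ^ L) _ _ small)) ⟩
  2 ^ L + (m ∸ 2 ^ L)                ≡⟨ m+[n∸m]≡n 2^L≤m ⟩
  m                                  ∎
  where
  open ≡-Reasoning
  small : 2 ^ L + (m ∸ 2 ^ L) < 2 ^ L + 2 ^ L
  small = subst (_< 2 ^ L + 2 ^ L) (sym (m+[n∸m]≡n 2^L≤m)) m<2^L

values-bits : ∀ L {ms} → All (_< 2 ^ L) ms → map value (map (bits L) ms) ≡ ms
values-bits L []       = refl
values-bits L (p ∷ ps) = cong₂ _∷_ (value-bits L p) (values-bits L ps)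

-- A sequence of binary words is written with the pairs (true , b) for the
-- letters and (false , true) after each word; (false , false) is padding.
word : List Bool → List Bool → List Bool
word []       rest = false ∷ true ∷ rest
word (b ∷ bs) rest = true ∷ b ∷ word bs rest

push : Bool → List (List Bool) → List (List Bool)
push b []         = (b ∷ []) ∷ []
push b (bs ∷ bss) = (b ∷ bs) ∷ bss

parse : List Bool → List (List Bool)
parse (true ∷ b ∷ rest)     = push b (parse rest)
parse (false ∷ true ∷ rest) = [] ∷ parse rest
parse _                     = []

parse-word : ∀ bs rest → parse (word bs rest) ≡ bs ∷ parse rest
parse-word []       rest = refl
parse-word (b ∷ bs) rest = cong (push b) (parse-word bs rest)

-- A lone final `false` also ends the parse, so padding of either parity is read correctly.
parse-words : ∀ k bss → parse (foldr word (replicate k false) bss) ≡ bss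
parse-words zero          []         = refl
parse-words (suc zero)    []         = refl
parse-words (suc (suc k)) []         = refl
parse-words k             (bs ∷ bss) = trans (parse-word bs _) (cong (bs ∷_) (parse-words k bss))

length-word : ∀ bs rest → length (word bs rest) ≡ 2 + 2 * length bs + length rest
length-word []       rest = refl
length-word (b ∷ bs) rest = trans (cong (2 +_) (length-word bs rest)) (step (length bs) (length rest))
  where
  step : ∀ m r → 2 + (2 + 2 * m + r) ≡ 2 + 2 * suc m + r
  step = solve-∀

length-words : ∀ L ms rest → length (foldr word rest (map (bits L) ms)) ≡ length ms * (2 + 2 * L) + length rest
length-words L []       rest = refl
length-words L (m ∷ ms) rest = begin
  length (word (bits L m) (foldr word rest (map (bits L) ms)))
    ≡⟨ length-word (bits L m) _ ⟩
  2 + 2 * length (bits L m) + length (foldr word rest (map (bits L) ms))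
    ≡⟨ cong₂ (λ l r → 2 + 2 * l + r) (length-bits L m) (length-words L ms rest) ⟩
  2 + 2 * L + (length ms * (2 + 2 * L) + length rest)
    ≡⟨ +-assoc (2 + 2 * L) (length ms * (2 + 2 * L)) (length rest) ⟨
  2 + 2 * L + length ms * (2 + 2 * L) + length rest ∎
  where open ≡-Reasoning

-- The parity of the number of turns at or before `j`: it tells whether `j` lies in one of the
-- intervals that the turns delimit.
flips : ℕ → List ℕ → Bool
flips j []       = false
flips j (t ∷ ts) = does (t ≤? j) xor flips j ts

turns : {V : Set} → (V → Bool) → Bool → ℕ → List V → List ℕ
turns f b i []       = []
turns f b i (x ∷ xs) = if b xor f x then i ∷ rest else rest
  where rest = turns f (f x) (suc i) xs

length-turns : ∀ {V : Set} (f : V → Bool) b i xs → length (turns f b i xs) ≡ changes f b xs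
length-turns f b i []       = refl
length-turns f b i (x ∷ xs) with b xor f x
... | true  = cong suc (length-turns f (f x) (suc i) xs)
... | false = length-turns f (f x) (suc i) xs

turns-lower : ∀ {V : Set} (f : V → Bool) b i xs → All (i ≤_) (turns f b i xs)
turns-lower f b i []       = []
turns-lower f b i (x ∷ xs) with b xor f x
... | true  = ≤-refl ∷ All.map <⇒≤ (turns-lower f (f x) (suc i) xs)
... | false = All.map <⇒≤ (turns-lower f (f x) (suc i) xs)

turns-upper : ∀ {V : Set} (f : V → Bool) b i xs → All (_< i + length xs) (turns f b i xs)
turns-upper f b i []       = []
turns-upper f b i (x ∷ xs) with rest ← turns-upper f (f x) (suc i) xs | b xor f x
... | true  = m<m+n i z<s ∷ All.map (λ p → ≤-trans p (≤-reflexive (sym (+-suc i (length xs))))) rest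
... | false = All.map (λ p → ≤-trans p (≤-reflexive (sym (+-suc i (length xs))))) rest

flips-above : ∀ j {ts} → All (j <_) ts → flips j ts ≡ false
flips-above j []                = refl
flips-above j {t ∷ _} (p ∷ ps) rewrite dec-false (t ≤? j) (<⇒≱ p) = flips-above j ps

-- If `b` and `f x` differ, the turn stored at `i` is counted because `i ≤ j`, and it makes up
-- exactly for this difference.
flips-turn : ∀ {V : Set} (f : V → Bool) b i x xs {j} → i ≤ j →
  b xor flips j (turns f b i (x ∷ xs)) ≡ f x xor flips j (turns f (f x) (suc i) xs)
flips-turn f b i x xs {j} i≤j with f x | b
... | true  | true  = refl
... | false | false = refl
... | true  | false rewrite dec-true (i ≤? j) i≤j = refl
... | false | true  rewrite dec-true (i ≤? j) i≤j = not-involutive _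

flips-turns : ∀ {V : Set} (f : V → Bool) b i xs (k : Fin (length xs)) →
  b xor flips (i + toℕ k) (turns f b i xs) ≡ f (List.lookup xs k)
flips-turns f b i (x ∷ xs) zero rewrite +-identityʳ i = begin
  b xor flips i (turns f b i (x ∷ xs))         ≡⟨ flips-turn f b i x xs ≤-refl ⟩
  f x xor flips i (turns f (f x) (suc i) xs)   ≡⟨ cong (f x xor_) (flips-above i (turns-lower f (f x) (suc i) xs)) ⟩
  f x xor false                                ≡⟨ xor-identityʳ (f x) ⟩
  f x                                          ∎
  where open ≡-Reasoning
flips-turns f b i (x ∷ xs) (suc k) = begin
  b xor flips (i + suc (toℕ k)) (turns f b i (x ∷ xs))
    ≡⟨ flips-turn f b i x xs (m≤m+n i _) ⟩
  f x xor flips (i + suc (toℕ k)) (turns f (f x) (suc i) xs)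
    ≡⟨ cong (λ j → f x xor flips j (turns f (f x) (suc i) xs)) (+-suc i (toℕ k)) ⟩
  f x xor flips (suc i + toℕ k) (turns f (f x) (suc i) xs)
    ≡⟨ flips-turns f (f x) (suc i) xs k ⟩
  f (List.lookup xs k) ∎
  where open ≡-Reasoning

-- A label starts with the position of its vertex, followed by the turns of its neighbourhood. The
-- turns of the first vertex are tested at the position of the second.
query : List ℕ → List ℕ → Bool
query (_ ∷ ts) (j ∷ _) = flips j ts
query _        _       = false

decode : List Bool → List Bool → Bool
decode u v = query (map value (parse u)) (map value (parse v))

module Labels {n : ℕ} (G : Graph n) (L M : ℕ) (n≤2^L : n ≤ 2 ^ L)
  (list : List (Fin n)) (cover : ∀ z → z ∈ list) (length≡ : length list ≡ n)
  (few : ∀ a → changes (adj G a) false list ≤ M) where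

  position : Fin n → Fin (length list)
  position x = Any.index (cover x)

  numbers : Fin n → List ℕ
  numbers x = toℕ (position x) ∷ turns (adj G x) false 0 list

  numbers<2^L : ∀ x → All (_< 2 ^ L) (numbers x)
  numbers<2^L x = below (toℕ<n (position x)) ∷ All.map below (turns-upper (adj G x) false 0 list)
    where
    below : ∀ {m} → m < length list → m < 2 ^ L
    below m< = ≤-trans m< (≤-trans (≤-reflexive length≡) n≤2^L)

  numbers-short : ∀ x → length (numbers x) * (2 + 2 * L) ≤ suc M * (2 + 2 * L)
  numbers-short x = *-monoˡ-≤ (2 + 2 * L) (s≤s (≤-trans (≤-reflexive (length-turns (adj G x) false 0 list)) (few x)))

  code : Fin n → List Bool
  code x = foldr word (replicate (suc M * (2 + 2 * L) ∸ length (numbers x) * (2 + 2 * L)) false) (map (bits L) (numbers x))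

  length-code : ∀ x → length (code x) ≡ suc M * (2 + 2 * L)
  length-code x = begin
    length (code x)
      ≡⟨ length-words L (numbers x) _ ⟩
    length (numbers x) * (2 + 2 * L) + length (replicate (suc M * (2 + 2 * L) ∸ length (numbers x) * (2 + 2 * L)) false)
      ≡⟨ cong (length (numbers x) * (2 + 2 * L) +_) (length-replicate _) ⟩
    length (numbers x) * (2 + 2 * L) + (suc M * (2 + 2 * L) ∸ length (numbers x) * (2 + 2 * L))
      ≡⟨ m+[n∸m]≡n (numbers-short x) ⟩
    suc M * (2 + 2 * L) ∎
    where open ≡-Reasoning

  label : Fin n → Vec Bool (suc M * (2 + 2 * L))
  label x = subst (Vec Bool) (length-code x) (fromList (code x))

  toList-label : ∀ x → toList (label x) ≡ code x
  toList-label x = trans (toList-subst (length-code x) (fromList (code x))) (toList∘fromList (code x))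
    where
    toList-subst : ∀ {k l} (eq : k ≡ l) (v : Vec Bool k) → toList (subst (Vec Bool) eq v) ≡ toList v
    toList-subst refl v = refl

  decode-numbers : ∀ x → map value (parse (toList (label x))) ≡ numbers x
  decode-numbers x = begin
    map value (parse (toList (label x)))   ≡⟨ cong (map value ∘ parse) (toList-label x) ⟩
    map value (parse (code x))             ≡⟨ cong (map value) (parse-words _ (map (bits L) (numbers x))) ⟩
    map value (map (bits L) (numbers x))   ≡⟨ values-bits L (numbers<2^L x) ⟩
    numbers x                              ∎
    where open ≡-Reasoning

  decode-label : ∀ x y → decode (toList (label x)) (toList (label y)) ≡ adj G x y
  decode-label x y = begin
    decode (toList (label x)) (toList (label y)) ≡⟨ cong₂ query (decode-numbers x) (decode-numbers y) ⟩
    flips (toℕ (position y)) (turns (adj G x) false 0 list) ≡⟨ flips-turns (adj G x) false 0 list (position y) ⟩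
    adj G x (List.lookup list (position y))      ≡⟨ cong (adj G x) (lookup-index (cover y)) ⟨
    adj G x y                                    ∎
    where open ≡-Reasoning

-- Bounds on crossings and label length.

n≤2^⌈log₂n⌉ : ∀ n → n ≤ 2 ^ ⌈log₂ n ⌉
n≤2^⌈log₂n⌉ = <-rec _ λ
  { zero          _   → z≤n
  ; (suc zero)    _   → ≤-refl
  ; (suc (suc m)) rec → begin
      2 + m                                       ≡⟨ ⌊n/2⌋+⌈n/2⌉≡n (2 + m) ⟨
      ⌊ 2 + m /2⌋ + ⌈ 2 + m /2⌉                   ≤⟨ +-monoˡ-≤ _ (⌊n/2⌋≤⌈n/2⌉ (2 + m)) ⟩
      ⌈ 2 + m /2⌉ + ⌈ 2 + m /2⌉                   ≡⟨ cong (⌈ 2 + m /2⌉ +_) (+-identityʳ _) ⟨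
      2 * ⌈ 2 + m /2⌉                             ≤⟨ *-monoʳ-≤ 2 (rec (⌈n/2⌉<n m)) ⟩
      2 * 2 ^ ⌈log₂ ⌈ 2 + m /2⌉ ⌉                 ≡⟨ cong (λ l → 2 * 2 ^ l) (⌈log₂⌈n/2⌉⌉≡⌈log₂n⌉∸1 (2 + m)) ⟩
      2 ^ ⌈log₂ 2 + m ⌉                           ∎
  }
  where open ≤-Reasoning

[n+k]!≤n!*[n+k]^k : ∀ n k → (n + k) ! ≤ n ! * (n + k) ^ k
[n+k]!≤n!*[n+k]^k n zero    rewrite +-identityʳ n = ≤-reflexive (sym (*-identityʳ (n !)))
[n+k]!≤n!*[n+k]^k n (suc k) rewrite +-suc n k = begin
  suc (n + k) * (n + k) !                 ≤⟨ *-monoʳ-≤ (suc (n + k)) ([n+k]!≤n!*[n+k]^k n k) ⟩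
  suc (n + k) * (n ! * (n + k) ^ k)       ≤⟨ *-monoʳ-≤ (suc (n + k)) (*-monoʳ-≤ (n !) (^-monoˡ-≤ k (n≤1+n (n + k)))) ⟩
  suc (n + k) * (n ! * suc (n + k) ^ k)   ≡⟨ swap (suc (n + k)) (n !) (suc (n + k) ^ k) ⟩
  n ! * (suc (n + k) * suc (n + k) ^ k)   ∎
  where
  open ≤-Reasoning
  swap : ∀ a b c → a * (b * c) ≡ b * (a * c)
  swap = solve-∀

-- The exponent of two that bounds `n * (n + D) ^ D` for `D = C * L`, given `n ≤ 2 ^ L` and hence
-- `n + D ≤ 2 ^ (L + C)`.
crossings : ℕ → ℕ → ℕ
crossings C L = L + (L + C) * (C * L)

-- The hypothesis is `bounded` for unit weights, whose total is `n`. The quotient of the two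
-- factorials is at most `(n + D) ^ D`.
crossings-bound : ∀ n C L κ → n ≤ 2 ^ L →
  n ! * (1 * 2 ^ κ) ≤ n * (n + C * L) ! → κ ≤ crossings C L
crossings-bound n C L κ n≤2^L bounded = ≮⇒≥ λ κ-large → <⇒≱ (^-monoʳ-< 2 (s≤s (s≤s z≤n)) κ-large) (begin
  2 ^ κ                               ≤⟨ *-cancelˡ-≤ (n !) {{n !≢0}} divided ⟩
  n * (n + D) ^ D                     ≤⟨ *-mono-≤ n≤2^L (^-monoˡ-≤ D n+D≤) ⟩
  2 ^ L * (2 ^ (L + C)) ^ D           ≡⟨ cong (2 ^ L *_) (^-*-assoc 2 (L + C) D) ⟩
  2 ^ L * 2 ^ ((L + C) * D)           ≡⟨ ^-distribˡ-+-* 2 L ((L + C) * D) ⟨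
  2 ^ crossings C L                   ∎)
  where
  open ≤-Reasoning
  D = C * L
  divided : n ! * 2 ^ κ ≤ n ! * (n * (n + D) ^ D)
  divided = begin
    n ! * 2 ^ κ               ≡⟨ cong (n ! *_) (*-identityˡ (2 ^ κ)) ⟨
    n ! * (1 * 2 ^ κ)         ≤⟨ bounded ⟩
    n * (n + D) !             ≤⟨ *-monoʳ-≤ n ([n+k]!≤n!*[n+k]^k n D) ⟩
    n * (n ! * (n + D) ^ D)   ≡⟨ swap n (n !) ((n + D) ^ D) ⟩
    n ! * (n * (n + D) ^ D)   ∎
    where
    swap : ∀ a b c → a * (b * c) ≡ b * (a * c)
    swap = solve-∀
  n+D≤ : n + D ≤ 2 ^ (L + C)
  n+D≤ = begin
    n + C * L           ≤⟨ +-mono-≤ n≤2^L (*-monoʳ-≤ C (<⇒≤ (n<2^n L))) ⟩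
    suc C * 2 ^ L       ≤⟨ *-monoˡ-≤ (2 ^ L) (n<2^n C) ⟩
    2 ^ C * 2 ^ L       ≡⟨ *-comm (2 ^ C) (2 ^ L) ⟩
    2 ^ L * 2 ^ C       ≡⟨ ^-distribˡ-+-* 2 L C ⟨
    2 ^ (L + C)         ∎

-- One position and at most `suc (2 * crossings C L)` turns, each number taking two bits per binary
-- digit and two for its end mark.
labelLength : ℕ → ℕ → ℕ
labelLength C L = suc (suc (2 * crossings C L)) * (2 + 2 * L)

labelLength-cubic : ∀ C L .{{_ : NonZero L}} → labelLength C L ≤ (16 + 8 * ((1 + C) * C)) * L ^ 3
labelLength-cubic C L = begin
  (2 + 2 * (L + (L + C) * (C * L))) * (2 + 2 * L)
    ≤⟨ *-mono-≤ (+-mono-≤ 2≤ (*-monoʳ-≤ 2 (+-mono-≤ (m≤m*n L L) (*-monoˡ-≤ (C * L) (+-monoʳ-≤ L (m≤m*n C L))))))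
                (+-monoˡ-≤ (2 * L) (m≤m*n 2 L)) ⟩
  (2 * (L * L) + 2 * (L * L + (L + C * L) * (C * L))) * (2 * L + 2 * L)
    ≡⟨ collect C L ⟩
  (16 + 8 * ((1 + C) * C)) * (L * (L * (L * 1))) ∎
  where
  open ≤-Reasoning
  2≤ : 2 ≤ 2 * (L * L)
  2≤ = m≤m*n 2 (L * L) {{m*n≢0 L L}}
  collect : ∀ C L → (2 * (L * L) + 2 * (L * L + (L + C * L) * (C * L))) * (2 * L + 2 * L)
    ≡ (16 + 8 * ((1 + C) * C)) * (L * (L * (L * 1)))
  collect = solve-∀

labelLength-IsOLog³ : ∀ C → IsOLog³ (λ n → labelLength C (suc ⌈log₂ n ⌉))
-- From `n = 2` on the logarithm is positive, so its successor is at most twice as large; the cube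
-- of this factor is the 8.
labelLength-IsOLog³ C = A * 8 , 2 , λ n 2≤n → begin
  labelLength C (suc ⌈log₂ n ⌉) ≤⟨ labelLength-cubic C (suc ⌈log₂ n ⌉) ⟩
  A * suc ⌈log₂ n ⌉ ^ 3         ≤⟨ *-monoʳ-≤ A (^-monoˡ-≤ 3 (suc≤2* (⌈log₂⌉-mono-≤ 2≤n))) ⟩
  A * (2 * ⌈log₂ n ⌉) ^ 3       ≡⟨ cong (A *_) (^-distribʳ-* 2 ⌈log₂ n ⌉ 3) ⟩
  A * (8 * ⌈log₂ n ⌉ ^ 3)       ≡⟨ *-assoc A 8 (⌈log₂ n ⌉ ^ 3) ⟨
  A * 8 * ⌈log₂ n ⌉ ^ 3         ∎
  where
  open ≤-Reasoning
  A = 16 + 8 * ((1 + C) * C)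
  suc≤2* : ∀ {l} → 1 ≤ l → suc l ≤ 2 * l
  suc≤2* {l} 1≤l = +-mono-≤ 1≤l (m≤m+n l 0)

sum-ones : ∀ n → sum {n} (λ _ → 1) ≡ n
sum-ones zero    = refl
sum-ones (suc n) = cong suc (sum-ones n)

-- Assembling the labeling scheme.

module Scheme {n : ℕ} (G : Graph n) (K d L : ℕ)
  .{{K≢0 : NonZero K}} .{{d≢0 : NonZero d}} .{{L≢0 : NonZero L}} (n≤2^L : n ≤ 2 ^ L)
  (few-edges : ∀ {s} B (p : Vec (Fin n) s) → edges (Traces.weight (adj G) B p) ≤ d * length B)
  (few-traces : ∀ {s} .{{_ : NonZero s}} → s * L ≤ 2 ^ L →
    ∀ B (p : Vec (Fin n) s) → support (Traces.weight (adj G) B p) ≤ K * (s * L)) where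

  open ClosePairs (adj G) n K d L n≤2^L few-edges few-traces
  open Reweighting (adj G) D n

  C : ℕ
  C = 16 * d * K

  all-vertices : length (allFin n) ≡ n
  all-vertices = length-tabulate {n = n} id

  vertex-order : Order (allFin n) (λ _ → 1)
  vertex-order = order close-pair n (allFin n) all-vertices ≤-refl _

  few-changes : ∀ a → changes (adj G a) false (Order.list vertex-order) ≤ suc (2 * crossings C L)
  few-changes a = ≤-trans (Order.few vertex-order a)
    (s≤s (*-monoʳ-≤ 2 (crossings-bound n C L (Order.cross vertex-order a) n≤2^L
      (subst₂ (λ k W → k ! * (1 * 2 ^ Order.cross vertex-order a) ≤ W * (k + D) !) all-vertices (sum-ones n)
        (Order.bounded vertex-order a)))))

  open Labels G L (suc (2 * crossings C L)) n≤2^L (Order.list vertex-order)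
    (λ z → Order.cover vertex-order (∈-allFin z)) (trans (Order.length≡ vertex-order) all-vertices) few-changes
    public using (label; decode-label)

module SmallClass (𝒳 : GraphClass) (hereditary : Hereditary 𝒳)
  (c : ℕ) (small : ∀ n → CardX≤ 𝒳 n ((n !) * suc c ^ n)) where

  K : ℕ
  K = traceFactor c

  d : ℕ
  d = 2 ^ (4 + K)

  few-edges : ∀ {n s} (G : Graph n) → X 𝒳 n G → ∀ B (p : Vec (Fin n) s) →
    edges (Traces.weight (adj G) B p) ≤ d * length B
  few-edges G G∈𝒳 B p with shatters-or-sparse (Traces.weight (adj G) B p) d
  ... | inj₁ shattered = ⊥-elim (Neighbourhoods.¬shatters 𝒳 hereditary c small G G∈𝒳 d {{m^n≢0 2 (4 + K)}} (vc-constant K) B p shattered)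
  ... | inj₂ sparse    = ≤-trans (≤-trans (m≤m+n _ _) sparse) (≤-reflexive (cong (d *_) (Traces.size-weight (adj G) B p)))

  scheme : LabelingScheme 𝒳 (λ n → labelLength (16 * d * K) (suc ⌈log₂ n ⌉))
  scheme = record
    { decoder = decode
    ; encoder = λ G G∈𝒳 → S.label G G∈𝒳
    ; correct = λ G G∈𝒳 → S.decode-label G G∈𝒳
    }
    where
    -- The successor keeps `L` nonzero for graphs with at most one vertex.
    module S {n : ℕ} (G : Graph n) (G∈𝒳 : X 𝒳 n G) = Scheme G K d (suc ⌈log₂ n ⌉) {{d≢0 = m^n≢0 2 (4 + K)}}
      (≤-trans (n≤2^⌈log₂n⌉ n) (^-monoʳ-≤ 2 (n≤1+n ⌈log₂ n ⌉)))
      (few-edges G G∈𝒳) (λ sL≤2^L → Neighbourhoods.support≤ 𝒳 hereditary c small G G∈𝒳 (suc ⌈log₂ n ⌉) sL≤2^L)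

theorem1p3 : (𝒳 : GraphClass) → Hereditary 𝒳 → Small 𝒳 →
    ∃[ b ] (IsOLog³ b × LabelingScheme 𝒳 b)
theorem1p3 𝒳 hereditary (c , small) = _ , labelLength-IsOLog³ _ , SmallClass.scheme 𝒳 hereditary c λ n gs gs∈𝒳 distinct →
  -- Raising the constant from `c` to `suc c` makes it nonzero, as the counting argument requires.
  ≤-trans (small n gs gs∈𝒳 distinct) (*-monoʳ-≤ (n !) (^-monoˡ-≤ n (n≤1+n c)))
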